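{- For every $n\geq 0$, $$p(n)=\sum_{j=0}^n(-1)^j\operatorname{sc}(j)\,\#\mathcal H_{\mathrm{even}}\bigl(2(n-j)\bigr),$$ where $p(n)$ is the number of partitions of $n$, $\operatorname{sc}(j)$ is the number of self-conjugate partitions of $j$, and $\mathcal H_{\mathrm{even}}(2m)$ is the set of partitions of $2m$ for which the hook length of every cell on the main diagonal is even.
   Context: A partition is self-conjugate if it equals its conjugate (transpose). Hook lengths are the usual hook lengths in the Young diagram. -}

module Defs where

open import Data.Nat
open import Data.Nat.Properties
open import Data.Nat.ListAction using (sum)
open import Data.Nat.Divisibility using (_∣_; _∣?_)
open import Data.Integer as ℤ using (ℤ)
open import Data.List using (List; []; _∷_; [_]; map; filter; concatMap; length; upTo)
open import Data.List.Properties using (≡-dec; ∷-injective)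
open import Data.List.Membership.Propositional using (_∈_; find; lose)
open import Data.List.Membership.Propositional.Properties
  using (∈-map⁺; ∈-map⁻; ∈-upTo⁺; ∈-upTo⁻; ∈-concatMap⁺; ∈-concatMap⁻)
open import Data.List.Relation.Unary.All as All using (All; []; _∷_)
import Data.List.Relation.Unary.All.Properties as All
import Data.List.Relation.Unary.AllPairs as AllPairs
import Data.List.Relation.Unary.AllPairs.Properties as AllPairs
open import Data.List.Relation.Unary.Any using (here)
open import Data.List.Relation.Unary.Linked using (Linked; []; [-]; _∷_)
import Data.List.Relation.Unary.Linked as Linked
open import Data.List.Relation.Unary.Unique.Propositional using (Unique; []; _∷_)
open import Data.List.Relation.Unary.Unique.Propositional.Properties
  using (concat⁺; map⁺; upTo⁺)
open import Data.Product using (_×_; _,_; ∃; proj₂)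
open import Function.Base using (_∘_)
open import Function.Bundles using (_⇔_; mk⇔)
open import Relation.Binary.PropositionalEquality
  using (_≡_; refl; sym; trans; cong)
open import Relation.Nullary.Decidable using (map′; _→-dec_)
open import Relation.Unary using (Pred; Decidable)

infix 4 _⊢_

record _⊢_ (ps : List ℕ) (n : ℕ) : Set where
  constructor mk⊢
  field
    decreasing : Linked _≥_ ps
    positive   : All (0 <_) ps
    sum≡       : sum ps ≡ n

-- The partitions of n with at most l parts, all of them at most k.
boxed : (l k n : ℕ) → List (List ℕ)
boxed _       k zero    = [ [] ]
boxed zero    k (suc n) = []
boxed (suc l) k (suc n) =
  concatMap (λ i → map (suc i ∷_) (boxed l (suc i) (n ∸ i))) (upTo (k ⊓ suc n))

partitions : ℕ → List (List ℕ)
partitions n = boxed n n n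

private
  boxed-sound : ∀ l k n {ps} → ps ∈ boxed l k n →
                Linked _≥_ (k ∷ ps) × All (0 <_) ps × sum ps ≡ n
  boxed-sound zero    k zero    (here refl) = [-] , [] , refl
  boxed-sound (suc l) k zero    (here refl) = [-] , [] , refl
  boxed-sound (suc l) k (suc n) ps∈
    with i , i∈ , ps∈i ← find (∈-concatMap⁻ (λ i → map (suc i ∷_) (boxed l (suc i) (n ∸ i)))
                                         {xs = upTo (k ⊓ suc n)} ps∈)
    with qs , qs∈ , refl ← ∈-map⁻ (suc i ∷_) ps∈i
    with dec , pos , sum≡ ← boxed-sound l (suc i) (n ∸ i) qs∈
    = (m≤n⊓o⇒m≤n k (suc n) (∈-upTo⁻ i∈) ∷ dec)
    , (z<s ∷ pos)
    , cong suc (trans (cong (i +_) sum≡)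
        (m+[n∸m]≡n (≤-pred (m≤n⊓o⇒m≤o k (suc n) (∈-upTo⁻ i∈)))))

  boxed-complete : ∀ l k n {ps} → n ≤ l → Linked _≥_ (k ∷ ps) →
                   All (0 <_) ps → sum ps ≡ n → ps ∈ boxed l k n
  boxed-complete zero    k zero    {[]}         n≤l dec pos eq = here refl
  boxed-complete (suc l) k zero    {[]}         n≤l dec pos eq = here refl
  boxed-complete l       k zero    {suc i ∷ ps} n≤l dec pos ()
  boxed-complete l       k n       {zero ∷ ps}  n≤l dec (() ∷ pos) eq
  boxed-complete (suc l) k (suc _) {suc i ∷ ps} (s≤s n≤l) (i<k ∷ dec) (_ ∷ pos) refl =
    ∈-concatMap⁺ _ (lose (∈-upTo⁺ (⊓-glb i<k (s≤s (m≤m+n i (sum ps)))))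
      (∈-map⁺ (suc i ∷_)
        (boxed-complete l (suc i) (i + sum ps ∸ i)
          (≤-trans (m∸n≤m (i + sum ps) i) n≤l) dec pos (sym (m+n∸m≡n i (sum ps))))))

  boxed-unique : ∀ l k n → Unique (boxed l k n)
  boxed-unique zero    k zero    = [] ∷ []
  boxed-unique (suc l) k zero    = [] ∷ []
  boxed-unique zero    k (suc n) = []
  boxed-unique (suc l) k (suc n) = concat⁺
    (All.map⁺ (All.universal
      (λ i → map⁺ (proj₂ ∘ ∷-injective) (boxed-unique l (suc i) (n ∸ i))) _))
    (AllPairs.map⁺ (AllPairs.map
      (λ { i≢j (p , q) → i≢j (same-head (∈-map⁻ _ p) (∈-map⁻ _ q)) })
      (upTo⁺ (k ⊓ suc n))))
    where
    same-head : ∀ {i j ps xss yss} →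
                ∃ (λ xs → xs ∈ xss × ps ≡ suc i ∷ xs) →
                ∃ (λ ys → ys ∈ yss × ps ≡ suc j ∷ ys) → i ≡ j
    same-head (_ , _ , refl) (_ , _ , refl) = refl

  head-bound : ∀ {n ps} → ps ⊢ n → Linked _≥_ (n ∷ ps)
  head-bound {ps = []}     _                  = [-]
  head-bound {ps = p ∷ ps} (mk⊢ dec _ refl) = m≤m+n p (sum ps) ∷ dec

∈-partitions : ∀ {n ps} → ps ∈ partitions n ⇔ ps ⊢ n
∈-partitions {n} = mk⇔
  (λ ps∈ → let dec , pos , eq = boxed-sound n n n ps∈ in mk⊢ (Linked.tail dec) pos eq)
  (λ ps⊢ → boxed-complete n n n ≤-refl (head-bound ps⊢) (_⊢_.positive ps⊢) (_⊢_.sum≡ ps⊢))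

partitions-unique : ∀ n → Unique (partitions n)
partitions-unique n = boxed-unique n n n

-- Rows and columns are numbered from 0; rows past the last one have length 0.
row : List ℕ → ℕ → ℕ
row []       _       = 0
row (p ∷ _)  zero    = p
row (_ ∷ ps) (suc i) = row ps i

conjugate : List ℕ → List ℕ
conjugate ps = map (λ j → length (filter (j <?_) ps)) (upTo (row ps 0))

SelfConjugate : Pred (List ℕ) _
SelfConjugate ps = conjugate ps ≡ ps

selfConjugate? : Decidable SelfConjugate
selfConjugate? ps = ≡-dec _≟_ (conjugate ps) ps

-- arm + leg + 1; meaningful only for cells of the diagram, i.e. j < row ps i.
hookLength : List ℕ → ℕ → ℕ → ℕ
hookLength ps i j = (row ps i ∸ suc j) + (row (conjugate ps) j ∸ suc i) + 1

EvenDiagonalHooks : Pred (List ℕ) _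
EvenDiagonalHooks ps = ∀ i → i < row ps i → 2 ∣ hookLength ps i i

private
  row-length : ∀ ps i {j} → j < row ps i → i < length ps
  row-length (p ∷ ps) zero    _ = z<s
  row-length (p ∷ ps) (suc i) r = s<s (row-length ps i r)

evenDiagonalHooks? : Decidable EvenDiagonalHooks
evenDiagonalHooks? ps = map′
  (λ h i i<r → h (row-length ps i i<r) i<r)
  (λ h {i} _ → h i)
  (allUpTo? (λ i → (i <? row ps i) →-dec (2 ∣? hookLength ps i i)) (length ps))

p : ℕ → ℕ
p n = length (partitions n)

sc : ℕ → ℕ
sc n = length (filter selfConjugate? (partitions n))

#Hₑᵥₑₙ : ℕ → ℕ
#Hₑᵥₑₙ n = length (filter evenDiagonalHooks? (partitions n))

-- ∑≤ n f is the sum of f j over 0 ≤ j ≤ n.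
∑≤ : ℕ → (ℕ → ℤ) → ℤ
∑≤ zero    f = f zero
∑≤ (suc n) f = ∑≤ n f ℤ.+ f (suc n)

-- Peeling off its diagonal hooks turns a partition with r of them into a list of r arbitrary
-- pairs (i , j): the excess of the arm and of the leg of each hook over the least values that the
-- next inner hook allows. The k-th pair from the outside contributes 2k - 1 + k (i + j) to the size.
-- The partition is self-conjugate iff i = j in all pairs, and its diagonal hooks are all even iff
-- i + j is odd in the innermost pair and even in the others. With (x)_r = (1 - x)...(1 - x^r), and
-- x marking half the size for even hooks, the generating functions for r hooks are therefore
--   all partitions    x^(r^2) / (x)_r^2
--   self-conjugate    x^(r^2) / ((1 - x^2)(1 - x^4)...(1 - x^(2r)))
--   even hooks        x^(r(r+1)/2) (1 + 1)(1 + x)...(1 + x^(r-1)) / (x)_r^2.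
-- Put T_k,r = x^(r(r+1)/2) (x^k + 1)(x^k + x)...(x^k + x^(r-1)) / (x)_r^2. Then T_0 is the last
-- family and T_k tends to the first one as k grows, while sum_r T_k,r = (1 + x^(k+1)) sum_r T_(k+1),r
-- telescopes. So the even-hook series is the partition series times (1 + x)(1 + x^2)..., and a
-- similar telescoping turns the signed self-conjugate series into (1 - x)(1 - x^3)...; the two
-- products are inverse to each other by Euler. Everything takes place in Z[x] / x^(n+1).

module Submission where

-- Sum and product identities in a commutative ring with a nilpotent element

module RingIdentities where

  open import Algebra.Bundles using (CommutativeRing)
  open import Data.Nat as ℕ using (ℕ; zero; suc)
  import Data.Nat.Properties as ℕ
  open import Relation.Binary.PropositionalEquality as ≡ using (_≡_)

  module Nilpotent {a₁ a₂} (R : CommutativeRing a₁ a₂) where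

    open CommutativeRing R
    open import Algebra.Properties.Semiring.Exp semiring
    open import Algebra.Properties.CommutativeSemiring.Exp commutativeSemiring using (^-distrib-*)
    open import Algebra.Properties.Ring ring using (-‿distribˡ-*; -‿distribʳ-*; -0#≈0#)
    open import Algebra.Properties.Group +-group using () renaming (∙-cancelʳ to +-cancelʳ)
    open import Algebra.Solver.Ring.NaturalCoefficients.Default commutativeSemiring
      using (solve; _:+_; _:*_; _:=_; con)
    open import Relation.Binary.Reasoning.Setoid setoid

    ∑ : ℕ → (ℕ → Carrier) → Carrier
    ∑ zero    f = f 0
    ∑ (suc n) f = ∑ n f + f (suc n)

    ∏ : ℕ → (ℕ → Carrier) → Carrier
    ∏ zero    f = 1#
    ∏ (suc n) f = ∏ n f * f n

    ∑-cong : ∀ n {f g} → (∀ i → f i ≈ g i) → ∑ n f ≈ ∑ n g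
    ∑-cong zero    eq = eq 0
    ∑-cong (suc n) eq = +-cong (∑-cong n eq) (eq (suc n))

    partial-geometric : ∀ y n → ∑ n (y ^_) + y ^ suc n ≈ 1# + y * ∑ n (y ^_)
    partial-geometric y zero    = refl
    partial-geometric y (suc n) = begin
      (∑ n (y ^_) + y ^ suc n) + y ^ suc (suc n)   ≈⟨ +-congʳ (partial-geometric y n) ⟩
      (1# + y * ∑ n (y ^_)) + y * y ^ suc n
        ≈⟨ solve 3 (λ y a b → (con 1 :+ y :* a) :+ y :* b := con 1 :+ y :* (a :+ b)) refl y (∑ n (y ^_)) (y ^ suc n) ⟩
      1# + y * (∑ n (y ^_) + y ^ suc n)             ∎

    -- `v` is carried from each index to the next, so only `v n` survives. Both uses take n = N and
    -- a `v` for which `v N` is divisible by x^(N+1), hence zero.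
    telescope : ∀ {u f g} (v : ℕ → Carrier) n →
                f 0 + v 0 ≈ u * g 0 →
                (∀ r → f (suc r) + v (suc r) ≈ u * g (suc r) + v r) →
                ∑ n f + v n ≈ u * ∑ n g
    telescope v zero base step = base
    telescope {u} {f} {g} v (suc n) base step = begin
      (∑ n f + f (suc n)) + v (suc n)      ≈⟨ +-assoc _ _ _ ⟩
      ∑ n f + (f (suc n) + v (suc n))      ≈⟨ +-congˡ (step n) ⟩
      ∑ n f + (u * g (suc n) + v n)        ≈⟨ solve 3 (λ a b c → a :+ (b :+ c) := (a :+ c) :+ b) refl _ _ _ ⟩
      (∑ n f + v n) + u * g (suc n)        ≈⟨ +-congʳ (telescope v n base step) ⟩
      u * ∑ n g + u * g (suc n)            ≈⟨ sym (distribˡ u _ _) ⟩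
      u * (∑ n g + g (suc n))              ∎

    iterate : ∀ {u} (F : ℕ → Carrier) → (∀ k → F k ≈ u k * F (suc k)) → ∀ n → F 0 ≈ ∏ n u * F n
    iterate F step zero    = sym (*-identityˡ _)
    iterate {u} F step (suc n) = begin
      F 0                          ≈⟨ iterate F step n ⟩
      ∏ n u * F n                  ≈⟨ *-congˡ (step n) ⟩
      ∏ n u * (u n * F (suc n))    ≈⟨ sym (*-assoc _ _ _) ⟩
      (∏ n u * u n) * F (suc n)    ∎

    module _ (x : Carrier) (N : ℕ) (nilpotent : x ^ suc N ≈ 0#) where

      vanish : ∀ m → x ^ (m ℕ.+ suc N) ≈ 0#
      vanish m = begin
        x ^ (m ℕ.+ suc N)     ≈⟨ ^-homo-* x m (suc N) ⟩
        x ^ m * x ^ suc N     ≈⟨ *-congˡ nilpotent ⟩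
        x ^ m * 0#            ≈⟨ zeroʳ _ ⟩
        0#                    ∎

      vanish-> : ∀ {m} → N ℕ.< m → x ^ m ≈ 0#
      vanish-> {m} N<m = trans (^-congʳ x (≡.sym (ℕ.m∸n+n≡m N<m))) (vanish (m ℕ.∸ suc N))

      geometric : ℕ → Carrier
      geometric k = ∑ N ((x ^ k) ^_)

      geometric-equation : ∀ k → geometric (suc k) ≈ 1# + x ^ suc k * geometric (suc k)
      geometric-equation k = begin
        geometric (suc k)                              ≈⟨ sym (+-identityʳ _) ⟩
        geometric (suc k) + 0#
          ≈⟨ +-congˡ (sym (trans (^-assocʳ x (suc k) (suc N)) (vanish-> (ℕ.m≤m+n (suc N) (k ℕ.* suc N))))) ⟩
        geometric (suc k) + (x ^ suc k) ^ suc N        ≈⟨ partial-geometric (x ^ suc k) N ⟩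
        1# + x ^ suc k * geometric (suc k)             ∎

      -- `geometric (suc k)` inverts 1 - x^(k+1): multiply the hypothesis by it and cancel the
      -- common summand `e * (y * g)`. This solves the recursion that a freely repeated part imposes
      -- on a generating function.
      geometric-unique : ∀ k {f g} → g ≈ f + x ^ suc k * g → g ≈ geometric (suc k) * f
      geometric-unique k {f} {g} eq = sym (+-cancelʳ (e * (y * g)) (e * f) g (begin
        e * f + e * (y * g)     ≈⟨ sym (distribˡ e _ _) ⟩
        e * (f + y * g)         ≈⟨ *-congˡ (sym eq) ⟩
        e * g                   ≈⟨ *-congʳ (geometric-equation k) ⟩
        (1# + y * e) * g        ≈⟨ solve 3 (λ y e g → (con 1 :+ y :* e) :* g := g :+ e :* (y :* g)) refl y e g ⟩
        g + e * (y * g)         ∎))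
        where
        y = x ^ suc k
        e = geometric (suc k)

      -- (1 - y)² Y = f for Y = f / (1 - y)², without subtraction.
      geometric² : ∀ k f → let y = x ^ suc k; e = geometric (suc k) in
                   e * (e * f) + y * y * (e * (e * f)) ≈ f + (y * (e * (e * f)) + y * (e * (e * f)))
      geometric² k f = begin
        Y + y * y * Y                          ≈⟨ +-congʳ Y≈ ⟩
        (Z + y * Y) + y * y * Y
          ≈⟨ solve 3 (λ y Y Z → (Z :+ y :* Y) :+ y :* y :* Y := (Z :+ y :* (y :* Y)) :+ y :* Y) refl y Y Z ⟩
        (Z + y * (y * Y)) + y * Y              ≈⟨ +-congʳ (+-congʳ Z≈) ⟩
        ((f + y * Z) + y * (y * Y)) + y * Y
          ≈⟨ solve 4 (λ f y Y Z → ((f :+ y :* Z) :+ y :* (y :* Y)) :+ y :* Y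
                   := f :+ (y :* (Z :+ y :* Y) :+ y :* Y)) refl f y Y Z ⟩
        f + (y * (Z + y * Y) + y * Y)          ≈⟨ +-congˡ (+-congʳ (*-congˡ (sym Y≈))) ⟩
        f + (y * Y + y * Y)                    ∎
        where
        y = x ^ suc k
        e = geometric (suc k)
        Z = e * f
        Y = e * Z
        unfold : ∀ h → e * h ≈ h + y * (e * h)
        unfold h = trans (*-congʳ (geometric-equation k))
          (solve 3 (λ y e h → (con 1 :+ y :* e) :* h := h :+ y :* (e :* h)) refl y e h)
        Z≈ = unfold f
        Y≈ = unfold Z

      -- x^{r(r+1)/2} ∏_{i<r} (x^k + x^i) / (x;x)_r²
      T : ℕ → ℕ → Carrier
      T k zero    = 1#
      T k (suc r) = (x ^ k + x ^ r) * (x ^ suc r * (geometric (suc r) * (geometric (suc r) * T k r)))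

      -- Among the factors x^(k+1) + x^i with i ≤ r, those with i > 0 are x times x^k + x^(i-1).
      -- This leaves x^r (x^(k+1) + 1) times the product in `T k r`.
      T-shift : ∀ k r → T (suc k) (suc r) ≈
        (x ^ k * x ^ suc r + x ^ r) * (x ^ suc r * (geometric (suc r) * (geometric (suc r) * T k r)))
      T-shift k zero = *-congʳ (+-congʳ (solve 2 (λ a x → x :* a := a :* (x :* con 1)) refl (x ^ k) x))
      T-shift k (suc r) = begin
        (x * a + x * b) * (x ^ suc (suc r) * (e * (e * T (suc k) (suc r))))
          ≈⟨ *-congˡ (*-congˡ (*-congˡ (*-congˡ (T-shift k r)))) ⟩
        (x * a + x * b) * (p * (e * (e * ((a * (x * b) + b) * U))))
          ≈⟨ solve 6 (λ x a b p e U → (x :* a :+ x :* b) :* (p :* (e :* (e :* ((a :* (x :* b) :+ b) :* U))))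
                   := (a :* (x :* (x :* b)) :+ x :* b) :* (p :* (e :* (e :* ((a :+ b) :* U))))) refl x a b p e U ⟩
        (a * (x * (x * b)) + x * b) * (p * (e * (e * ((a + b) * U)))) ∎
        where
        a = x ^ k
        b = x ^ r
        p = x ^ suc (suc r)
        e = geometric (suc (suc r))
        U = x ^ suc r * (geometric (suc r) * (geometric (suc r) * T k r))

      -- Every T here is a multiple of Y = T k r / (1 - x^{r+1})², T k r itself by geometric².
      T-telescopes : ∀ k r →
        T k (suc r) + x * x ^ k * x ^ suc r * T k (suc r) ≈
        (1# + x * x ^ k) * T (suc k) (suc r) + x * x ^ k * x ^ r * T k r
      T-telescopes k r = begin
        (a + b) * (x * b * Y) + x * a * (x * b) * ((a + b) * (x * b * Y))
          ≈⟨ solve 4 (λ x a b Y → (a :+ b) :* (x :* b :* Y) :+ x :* a :* (x :* b) :* ((a :+ b) :* (x :* b :* Y))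
                   := a :* (x :* b) :* (Y :+ x :* b :* (x :* b) :* Y) :+ (b :* (x :* b :* Y) :+ x :* a :* (x :* b) :* (a :* (x :* b :* Y)))) refl x a b Y ⟩
        a * (x * b) * (Y + x * b * (x * b) * Y) + (b * (x * b * Y) + x * a * (x * b) * (a * (x * b * Y)))
          ≈⟨ +-congʳ (*-congˡ (geometric² r t)) ⟩
        a * (x * b) * (t + (x * b * Y + x * b * Y)) + (b * (x * b * Y) + x * a * (x * b) * (a * (x * b * Y)))
          ≈⟨ solve 5 (λ x a b Y t → a :* (x :* b) :* (t :+ (x :* b :* Y :+ x :* b :* Y)) :+ (b :* (x :* b :* Y) :+ x :* a :* (x :* b) :* (a :* (x :* b :* Y)))
                   := (con 1 :+ x :* a) :* ((a :* (x :* b) :+ b) :* (x :* b :* Y)) :+ x :* a :* b :* t) refl x a b Y t ⟩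
        (1# + x * a) * ((a * (x * b) + b) * (x * b * Y)) + x * a * b * t
          ≈⟨ +-congʳ (*-congˡ (sym (T-shift k r))) ⟩
        (1# + x * a) * T (suc k) (suc r) + x * a * b * t ∎
        where
        a = x ^ k
        b = x ^ r
        t = T k r
        Y = geometric (suc r) * (geometric (suc r) * t)

      ∑T-step : ∀ k → ∑ N (T k) ≈ (1# + x ^ suc k) * ∑ N (T (suc k))
      ∑T-step k = begin
        ∑ N (T k)                                    ≈⟨ sym (+-identityʳ _) ⟩
        ∑ N (T k) + 0#                               ≈⟨ +-congˡ (sym last≈0) ⟩
        ∑ N (T k) + x * x ^ k * x ^ N * T k N        ≈⟨ telescope (λ r → x * x ^ k * x ^ r * T k r) N base (T-telescopes k) ⟩
        (1# + x ^ suc k) * ∑ N (T (suc k))           ∎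
        where
        last≈0 : x * x ^ k * x ^ N * T k N ≈ 0#
        last≈0 = begin
          x * x ^ k * x ^ N * T k N
            ≈⟨ solve 4 (λ x a b t → x :* a :* b :* t := x :* b :* (a :* t)) refl x (x ^ k) (x ^ N) (T k N) ⟩
          x ^ suc N * (x ^ k * T k N)   ≈⟨ *-congʳ nilpotent ⟩
          0# * (x ^ k * T k N)          ≈⟨ zeroˡ _ ⟩
          0#                            ∎
        base : 1# + x * x ^ k * 1# * 1# ≈ (1# + x * x ^ k) * 1#
        base = solve 1 (λ a → con 1 :+ a :* con 1 :* con 1 := (con 1 :+ a) :* con 1) refl (x * x ^ k)

      module _ (s : ℕ → Carrier) (s-zero : s 0 ≈ 1#)
               (s-suc : ∀ r → s (suc r) + x ^ suc (r ℕ.+ r) * s r ≈ x ^ (suc r ℕ.+ suc r) * s (suc r))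
               where

        -- `s-zero` and `s-suc` amount to s_r = (-1)^r x^(r^2) / ((1 - x^2)...(1 - x^(2r))). `U k r`
        -- is z^r s_r at z = x^(2k); the sum F(z) of all z^r s_r satisfies Euler's equation F(z) =
        -- (1 - zx) F(z x^2).
        U : ℕ → ℕ → Carrier
        U k r = ((x ^ k) ^ r * (x ^ k) ^ r) * s r

        -- The coefficients of z^(r+1) on both sides of F(z) = (1 - zx) F(z x^2), with the negative
        -- term moved across.
        U-step : ∀ k r → U k (suc r) + x * (x ^ k * x ^ k) * U (suc k) r ≈ U (suc k) (suc r)
        U-step k r = begin
          U k (suc r) + p * ((x * c) ^ r * (x * c) ^ r * s r)
            ≈⟨ +-congˡ (*-congˡ (*-congʳ (*-cong xc^r xc^r))) ⟩
          c * A * (c * A) * s (suc r) + p * (B * A * (B * A) * s r)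
            ≈⟨ solve 6 (λ x c A B s₀ s₁ → c :* A :* (c :* A) :* s₁ :+ x :* (c :* c) :* (B :* A :* (B :* A) :* s₀)
                     := c :* A :* (c :* A) :* (s₁ :+ x :* (B :* B) :* s₀)) refl x c A B (s r) (s (suc r)) ⟩
          c * A * (c * A) * (s (suc r) + x * (B * B) * s r)
            ≈⟨ *-congˡ (trans (+-congˡ (*-congʳ (*-congˡ (sym (^-homo-* x r r))))) (trans (s-suc r) (*-congʳ (^-homo-* x (suc r) (suc r))))) ⟩
          c * A * (c * A) * (x * B * (x * B) * s (suc r))
            ≈⟨ solve 5 (λ x c A B s₁ → c :* A :* (c :* A) :* (x :* B :* (x :* B) :* s₁)
                     := x :* c :* (B :* A) :* (x :* c :* (B :* A)) :* s₁) refl x c A B (s (suc r)) ⟩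
          x * c * (B * A) * (x * c * (B * A)) * s (suc r)
            ≈⟨ *-congʳ (*-cong (*-congˡ (sym xc^r)) (*-congˡ (sym xc^r))) ⟩
          U (suc k) (suc r) ∎
          where
          c = x ^ k
          A = c ^ r
          B = x ^ r
          p = x * (c * c)
          xc^r : (x * c) ^ r ≈ B * A
          xc^r = ^-distrib-* x c r

        ∑U-step : ∀ k → ∑ N (U k) ≈ (1# + - (x * (x ^ k * x ^ k))) * ∑ N (U (suc k))
        ∑U-step k = begin
          ∑ N (U k)                          ≈⟨ sym (+-identityʳ _) ⟩
          ∑ N (U k) + 0#                     ≈⟨ +-congˡ (sym last≈0) ⟩
          ∑ N (U k) + m * U (suc k) N        ≈⟨ telescope (λ r → m * U (suc k) r) N base step ⟩
          (1# + m) * ∑ N (U (suc k))         ∎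
          where
          c = x ^ k
          p = x * (c * c)
          m = - p
          base : 1# * 1# * s 0 + m * (1# * 1# * s 0) ≈ (1# + m) * (1# * 1# * s 0)
          base = solve 2 (λ s m → s :+ m :* s := (con 1 :+ m) :* s) refl (1# * 1# * s 0) m
          step : ∀ r → U k (suc r) + m * U (suc k) (suc r) ≈ (1# + m) * U (suc k) (suc r) + m * U (suc k) r
          step r = begin
            f + m * g₁                                ≈⟨ sym (+-identityʳ _) ⟩
            -- Zero is inserted as `(p + m) * g₀`: `p * g₀` completes the left side of `U-step`, and
            -- `m * g₀` is the term carried along by `telescope`.
            f + m * g₁ + 0#                           ≈⟨ +-congˡ (sym (trans (*-congʳ (-‿inverseʳ p)) (zeroˡ g₀))) ⟩
            f + m * g₁ + (p + m) * g₀
              ≈⟨ solve 5 (λ f m p g₁ g₀ → f :+ m :* g₁ :+ (p :+ m) :* g₀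
                       := (f :+ p :* g₀) :+ (m :* g₁ :+ m :* g₀)) refl f m p g₁ g₀ ⟩
            (f + p * g₀) + (m * g₁ + m * g₀)          ≈⟨ +-congʳ (U-step k r) ⟩
            g₁ + (m * g₁ + m * g₀)
              ≈⟨ solve 3 (λ m g₁ g₀ → g₁ :+ (m :* g₁ :+ m :* g₀) := (con 1 :+ m) :* g₁ :+ m :* g₀) refl m g₁ g₀ ⟩
            (1# + m) * g₁ + m * g₀                    ∎
            where
            f = U k (suc r)
            g₁ = U (suc k) (suc r)
            g₀ = U (suc k) r
          last≈0 : m * U (suc k) N ≈ 0#
          last≈0 = begin
            - (x * (c * c)) * ((x * c) ^ N * (x * c) ^ N * s N)
              ≈⟨ *-cong (-‿distribˡ-* x (c * c)) (*-congʳ (*-congʳ (^-distrib-* x c N))) ⟩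
            - x * (c * c) * (x ^ N * c ^ N * (x * c) ^ N * s N)
              -- The sign becomes a separate factor `- 1#`, a variable for the solver, so that `x`
              -- and `x ^ N` can be brought together.
              ≈⟨ *-congʳ (*-congʳ (trans (-‿cong (sym (*-identityʳ x))) (-‿distribʳ-* x 1#))) ⟩
            x * - 1# * (c * c) * (x ^ N * c ^ N * (x * c) ^ N * s N)
              ≈⟨ solve 7 (λ x l c y d e s → x :* l :* (c :* c) :* (y :* d :* e :* s)
                       := x :* y :* (l :* (c :* c) :* d :* e :* s)) refl x (- 1#) c (x ^ N) (c ^ N) ((x * c) ^ N) (s N) ⟩
            x ^ suc N * (- 1# * (c * c) * c ^ N * (x * c) ^ N * s N)
              ≈⟨ *-congʳ nilpotent ⟩
            0# * (- 1# * (c * c) * c ^ N * (x * c) ^ N * s N)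
              ≈⟨ zeroˡ _ ⟩
            0# ∎

        -- Every term with r > 0 has a factor x^(N+1), so only `s 0` remains.
        ∑U-limit : ∀ n → ∑ n (U (suc N)) ≈ 1#
        ∑U-limit zero    = trans (*-cong (*-identityˡ 1#) s-zero) (*-identityˡ 1#)
        ∑U-limit (suc n) = trans (+-cong (∑U-limit n) (trans (*-congʳ (trans (*-congʳ (trans (*-congʳ nilpotent) (zeroˡ _))) (zeroˡ _))) (zeroˡ _))) (+-identityʳ 1#)

        ∑s-product : ∑ N s ≈ ∏ (suc N) (λ k → 1# + - (x * (x ^ k * x ^ k)))
        ∑s-product = begin
          ∑ N s
            ≈⟨ ∑-cong N (λ r → sym (trans (*-congʳ (trans (*-cong (one^ r) (one^ r)) (*-identityˡ 1#))) (*-identityˡ (s r)))) ⟩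
          ∑ N (U 0)                     ≈⟨ iterate (λ k → ∑ N (U k)) ∑U-step (suc N) ⟩
          ∏ (suc N) _ * ∑ N (U (suc N)) ≈⟨ *-congˡ (∑U-limit N) ⟩
          ∏ (suc N) _ * 1#              ≈⟨ *-identityʳ _ ⟩
          ∏ (suc N) _                   ∎
          where
          one^ : ∀ r → 1# ^ r ≈ 1#
          one^ zero    = refl
          one^ (suc r) = trans (*-identityˡ _) (one^ r)

      -- For `n` = N + 1, `Q n * W n` collects the factors 1 - x^(2k) with 1 ≤ k ≤ n and `O n` the
      -- odd ones, so the three products together make `W (n + n)`. Factors beyond degree N are 1,
      -- so this is `W n` again, and `W n` cancels against its inverse `G n`.
      euler : ∏ (suc N) (λ k → 1# + - (x * (x ^ k * x ^ k))) * ∏ (suc N) (λ k → 1# + x ^ suc k) ≈ 1#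
      euler = begin
        O n * Q n                   ≈⟨ sym (*-identityʳ _) ⟩
        O n * Q n * 1#              ≈⟨ *-congˡ (sym (W-inverse n)) ⟩
        O n * Q n * (W n * G n)     ≈⟨ sym (*-assoc _ _ _) ⟩
        O n * Q n * W n * G n       ≈⟨ *-congʳ (OQW n) ⟩
        W (n ℕ.+ n) * G n           ≈⟨ *-congʳ (W-stable n) ⟩
        W n * G n                   ≈⟨ W-inverse n ⟩
        1#                          ∎
        where
        n = suc N
        O Q W G : ℕ → Carrier
        O m = ∏ m (λ k → 1# + - (x * (x ^ k * x ^ k)))
        Q m = ∏ m (λ k → 1# + x ^ suc k)
        W m = ∏ m (λ k → 1# + - (x ^ suc k))
        G m = ∏ m (λ k → geometric (suc k))

        factor-inverse : ∀ k → (1# + - (x ^ suc k)) * geometric (suc k) ≈ 1#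
        factor-inverse k = begin
          (1# + - y) * e             ≈⟨ solve 2 (λ m e → (con 1 :+ m) :* e := e :+ m :* e) refl (- y) e ⟩
          e + - y * e                ≈⟨ +-congʳ (geometric-equation k) ⟩
          1# + y * e + - y * e       ≈⟨ solve 3 (λ y m e → con 1 :+ y :* e :+ m :* e := con 1 :+ (y :+ m) :* e) refl y (- y) e ⟩
          1# + (y + - y) * e         ≈⟨ +-congˡ (trans (*-congʳ (-‿inverseʳ y)) (zeroˡ e)) ⟩
          1# + 0#                    ≈⟨ +-identityʳ 1# ⟩
          1#                         ∎
          where
          y = x ^ suc k
          e = geometric (suc k)

        W-inverse : ∀ m → W m * G m ≈ 1#
        W-inverse zero    = *-identityˡ 1#
        W-inverse (suc m) = begin
          W m * w * (G m * g)     ≈⟨ solve 4 (λ a b c d → a :* b :* (c :* d) := a :* c :* (b :* d)) refl (W m) w (G m) g ⟩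
          W m * G m * (w * g)     ≈⟨ *-cong (W-inverse m) (factor-inverse m) ⟩
          1# * 1#                 ≈⟨ *-identityˡ 1# ⟩
          1#                      ∎
          where
          w = 1# + - (x ^ suc m)
          g = geometric (suc m)

        W-stable : ∀ m → W (m ℕ.+ n) ≈ W n
        W-stable zero    = refl
        W-stable (suc m) = begin
          W (m ℕ.+ n) * (1# + - (x ^ suc (m ℕ.+ n)))   ≈⟨ *-cong (W-stable m) (+-congˡ (-‿cong (vanish (suc m)))) ⟩
          W n * (1# + - 0#)                            ≈⟨ *-congˡ (+-congˡ -0#≈0#) ⟩
          W n * (1# + 0#)                              ≈⟨ *-congˡ (+-identityʳ 1#) ⟩
          W n * 1#                                     ≈⟨ *-identityʳ _ ⟩
          W n                                          ∎

        difference-of-squares : ∀ y → (1# + - y) * (1# + y) ≈ 1# + - (y * y)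
        difference-of-squares y = begin
          (1# + - y) * (1# + y)
            ≈⟨ solve 2 (λ y m → (con 1 :+ m) :* (con 1 :+ y) := con 1 :+ m :* y :+ (y :+ m)) refl y (- y) ⟩
          1# + - y * y + (y + - y)       ≈⟨ +-congˡ (-‿inverseʳ y) ⟩
          1# + - y * y + 0#              ≈⟨ +-identityʳ _ ⟩
          1# + - y * y                   ≈⟨ +-congˡ (sym (-‿distribˡ-* y y)) ⟩
          1# + - (y * y)                 ∎

        OQW : ∀ m → O m * Q m * W m ≈ W (m ℕ.+ m)
        OQW zero    = trans (*-identityʳ _) (*-identityʳ _)
        OQW (suc m) = begin
          O m * o * (Q m * (1# + y)) * (W m * (1# + - y))
            ≈⟨ solve 6 (λ a o b u c v → a :* o :* (b :* u) :* (c :* v)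
                     := a :* b :* c :* o :* (v :* u)) refl (O m) o (Q m) (1# + y) (W m) (1# + - y) ⟩
          O m * Q m * W m * o * ((1# + - y) * (1# + y))
            ≈⟨ *-cong (*-cong (OQW m) (+-congˡ (-‿cong (*-congˡ (sym (^-homo-* x m m)))))) (trans (difference-of-squares y) (+-congˡ (-‿cong (sym (^-homo-* x (suc m) (suc m)))))) ⟩
          W (m ℕ.+ m) * (1# + - (x ^ suc (m ℕ.+ m))) * (1# + - (x ^ (suc m ℕ.+ suc m)))
            ≡⟨ ≡.cong (λ j → W (suc (m ℕ.+ m)) * (1# + - (x ^ suc j))) (ℕ.+-suc m m) ⟩
          W (suc (suc (m ℕ.+ m)))
            ≡⟨ ≡.cong (λ j → W (suc j)) (≡.sym (ℕ.+-suc m m)) ⟩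
          W (suc m ℕ.+ suc m) ∎
          where
          y = x ^ suc m
          o = 1# + - (x * (x ^ m * x ^ m))

      module _ (D : ℕ → Carrier) (D-zero : D 0 ≈ 1#)
               (D-suc : ∀ r → D (suc r) ≈ x ^ suc (r ℕ.+ r) * (geometric (suc r) * (geometric (suc r) * D r)))
               where

        -- Once x^k vanishes, the factors x^k + x^i become x^i. They multiply to x^(r(r-1)/2), which
        -- completes x^(r(r+1)/2) to x^(r^2).
        T-limit : ∀ r → T (suc N) r ≈ D r
        T-limit zero    = sym D-zero
        T-limit (suc r) = begin
          (x ^ suc N + b) * (x * b * (e * (e * T (suc N) r)))
            ≈⟨ *-cong (+-congʳ nilpotent) (*-congˡ (*-congˡ (*-congˡ (T-limit r)))) ⟩
          (0# + b) * (x * b * (e * (e * D r)))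
            ≈⟨ solve 4 (λ x b e d → (con 0 :+ b) :* (x :* b :* (e :* (e :* d)))
                     := x :* (b :* b) :* (e :* (e :* d))) refl x b e (D r) ⟩
          x * (b * b) * (e * (e * D r))                         ≈⟨ *-congʳ (*-congˡ (sym (^-homo-* x r r))) ⟩
          x ^ suc (r ℕ.+ r) * (e * (e * D r))                   ≈⟨ sym (D-suc r) ⟩
          D (suc r)                                             ∎
          where
          b = x ^ r
          e = geometric (suc r)

        ∑T-product : ∑ N (T 0) ≈ ∏ (suc N) (λ k → 1# + x ^ suc k) * ∑ N D
        ∑T-product = trans (iterate (λ k → ∑ N (T k)) ∑T-step (suc N)) (*-congˡ (∑-cong N T-limit))

      module _ (Ev E : ℕ → Carrier) (Ev-zero : Ev 0 ≈ 1#) (E-zero : E 0 ≈ 1#)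
               (Ev-suc : ∀ r → Ev (suc r) ≈ (1# + x ^ suc r) * (x ^ suc r * (geometric (suc r) * (geometric (suc r) * Ev r))))
               (E-suc : ∀ r → E (suc r) ≈ (1# + 1#) * (x ^ suc r * (geometric (suc r) * (geometric (suc r) * Ev r))))
               where

        -- `Ev r` has the factors (1 + x)...(1 + x^r), and `T 0 r` has (1 + 1)(1 + x)...(1 +
        -- x^(r-1)). Each side is multiplied by what the other has in excess, so nothing is divided
        -- by 2; `E (suc r)` brings exactly this factor 2.
        Ev≈T : ∀ r → (1# + 1#) * Ev r ≈ (1# + x ^ r) * T 0 r
        Ev≈T zero    = *-congˡ Ev-zero
        Ev≈T (suc r) = begin
          (1# + 1#) * Ev (suc r)                                 ≈⟨ *-congˡ (Ev-suc r) ⟩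
          (1# + 1#) * ((1# + q) * (q * (e * (e * Ev r))))
            ≈⟨ solve 4 (λ w q e v → w :* ((con 1 :+ q) :* (q :* (e :* (e :* v))))
                     := (con 1 :+ q) :* (q :* (e :* (e :* (w :* v))))) refl (1# + 1#) q e (Ev r) ⟩
          (1# + q) * (q * (e * (e * ((1# + 1#) * Ev r))))        ≈⟨ *-congˡ (*-congˡ (*-congˡ (*-congˡ (Ev≈T r)))) ⟩
          (1# + q) * (q * (e * (e * ((1# + x ^ r) * T 0 r))))
            ≈⟨ solve 4 (λ w q e v → (con 1 :+ q) :* (q :* (e :* (e :* (w :* v))))
                     := (con 1 :+ q) :* (w :* (q :* (e :* (e :* v))))) refl (1# + x ^ r) q e (T 0 r) ⟩
          (1# + q) * T 0 (suc r)                                 ∎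
          where
          q = x ^ suc r
          e = geometric (suc r)

        E≈T : ∀ r → E r ≈ T 0 r
        E≈T zero    = E-zero
        E≈T (suc r) = begin
          E (suc r)                                       ≈⟨ E-suc r ⟩
          (1# + 1#) * (q * (e * (e * Ev r)))              ≈⟨ pull (1# + 1#) (Ev r) ⟩
          q * (e * (e * ((1# + 1#) * Ev r)))              ≈⟨ *-congˡ (*-congˡ (*-congˡ (Ev≈T r))) ⟩
          q * (e * (e * ((1# + x ^ r) * T 0 r)))          ≈⟨ sym (pull (1# + x ^ r) (T 0 r)) ⟩
          T 0 (suc r)                                     ∎
          where
          q = x ^ suc r
          e = geometric (suc r)
          pull : ∀ w v → w * (q * (e * (e * v))) ≈ q * (e * (e * (w * v)))
          pull = solve 4 (λ q e w v → w :* (q :* (e :* (e :* v))) := q :* (e :* (e :* (w :* v)))) refl q e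

      product-identity : ∀ {D s Ev E : ℕ → Carrier} →
        D 0 ≈ 1# → s 0 ≈ 1# → Ev 0 ≈ 1# → E 0 ≈ 1# →
        (∀ r → D (suc r) ≈ x ^ suc (r ℕ.+ r) * (geometric (suc r) * (geometric (suc r) * D r))) →
        (∀ r → s (suc r) + x ^ suc (r ℕ.+ r) * s r ≈ x ^ (suc r ℕ.+ suc r) * s (suc r)) →
        (∀ r → Ev (suc r) ≈ (1# + x ^ suc r) * (x ^ suc r * (geometric (suc r) * (geometric (suc r) * Ev r)))) →
        (∀ r → E (suc r) ≈ (1# + 1#) * (x ^ suc r * (geometric (suc r) * (geometric (suc r) * Ev r)))) →
        ∑ N s * ∑ N E ≈ ∑ N D
      product-identity {D} {s} {Ev} {E} D0 s0 Ev0 E0 D+ s+ Ev+ E+ = begin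
        ∑ N s * ∑ N E
          ≈⟨ *-cong (∑s-product s s0 s+) (∑-cong N (E≈T Ev E Ev0 E0 Ev+ E+)) ⟩
        ∏ (suc N) _ * ∑ N (T 0)
          ≈⟨ *-congˡ (∑T-product D D0 D+) ⟩
        ∏ (suc N) _ * (∏ (suc N) _ * ∑ N D)
          ≈⟨ sym (*-assoc _ _ _) ⟩
        (∏ (suc N) _ * ∏ (suc N) _) * ∑ N D
          ≈⟨ *-congʳ euler ⟩
        1# * ∑ N D
          ≈⟨ *-identityˡ _ ⟩
        ∑ N D ∎

-- Integer power series up to a fixed degree

module TruncatedSeries where

  open import Algebra.Bundles using (CommutativeRing)
  open import Data.Integer using (ℤ; 0ℤ; 1ℤ; _+_; _*_; -_)
  import Data.Integer.Properties as ℤ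
  open import Data.Integer.Tactic.RingSolver using (solve-∀)
  open import Data.Nat as ℕ using (ℕ; zero; suc; z≤n; s≤s)
  import Data.Nat.Properties as ℕ
  open import Data.Product using (_,_)
  open import Relation.Binary.PropositionalEquality using (_≡_; refl; sym; trans; cong; cong₂; module ≡-Reasoning)
  open import Function using (_∘_)

  Series : Set
  Series = ℕ → ℤ

  infixl 7 _⊛_

  _⊛_ : Series → Series → Series
  (f ⊛ g) zero    = f 0 * g 0
  (f ⊛ g) (suc n) = f 0 * g (suc n) + (f ∘ suc ⊛ g) n

  0ₛ 1ₛ x : Series
  0ₛ _       = 0ℤ
  1ₛ zero    = 1ℤ
  1ₛ (suc _) = 0ℤ
  x zero     = 0ℤ
  x (suc n)  = 1ₛ n

  module _ where
    open ≡-Reasoning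

    -- Coefficient n of a product involves only coefficients up to n, so multiplication respects
    -- equality up to degree N.
    ⊛-cong : ∀ n {f f′ g g′} → (∀ {i} → i ℕ.≤ n → f i ≡ f′ i) → (∀ {i} → i ℕ.≤ n → g i ≡ g′ i) →
             (f ⊛ g) n ≡ (f′ ⊛ g′) n
    ⊛-cong zero    p q = cong₂ _*_ (p z≤n) (q z≤n)
    ⊛-cong (suc n) p q = cong₂ _+_ (cong₂ _*_ (p z≤n) (q ℕ.≤-refl))
      (⊛-cong n (λ i≤n → p (s≤s i≤n)) (λ i≤n → q (ℕ.m≤n⇒m≤1+n i≤n)))

    ⊛-zeroˡ : ∀ n g → (0ₛ ⊛ g) n ≡ 0ℤ
    ⊛-zeroˡ zero    g = refl
    ⊛-zeroˡ (suc n) g = trans (ℤ.+-identityˡ _) (⊛-zeroˡ n g)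

    ⊛-identityˡ : ∀ n g → (1ₛ ⊛ g) n ≡ g n
    ⊛-identityˡ zero    g = ℤ.*-identityˡ (g 0)
    ⊛-identityˡ (suc n) g = trans (cong₂ _+_ (ℤ.*-identityˡ (g (suc n))) (⊛-zeroˡ n g)) (ℤ.+-identityʳ _)

    x⊛-suc : ∀ n g → (x ⊛ g) (suc n) ≡ g n
    x⊛-suc n g = trans (ℤ.+-identityˡ _) (⊛-identityˡ n g)

    ⊛-distribʳ : ∀ n h f g → ((λ i → f i + g i) ⊛ h) n ≡ (f ⊛ h) n + (g ⊛ h) n
    ⊛-distribʳ zero    h f g = ℤ.*-distribʳ-+ (h 0) (f 0) (g 0)
    ⊛-distribʳ (suc n) h f g = trans
      (cong ((f 0 + g 0) * h (suc n) +_) (⊛-distribʳ n h (f ∘ suc) (g ∘ suc)))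
      (solve-5 (f 0) (g 0) (h (suc n)) _ _)
      where
      solve-5 : ∀ a b c d e → (a + b) * c + (d + e) ≡ a * c + d + (b * c + e)
      solve-5 = solve-∀

    *-⊛ : ∀ n a f g → ((λ i → a * f i) ⊛ g) n ≡ a * (f ⊛ g) n
    *-⊛ zero    a f g = ℤ.*-assoc a (f 0) (g 0)
    *-⊛ (suc n) a f g = trans (cong (a * f 0 * g (suc n) +_) (*-⊛ n a (f ∘ suc) g))
      (factor a (f 0) (g (suc n)) _)
      where
      factor : ∀ a b c d → a * b * c + a * d ≡ a * (b * c + d)
      factor = solve-∀

    -- By definition the tail of `f ⊛ g` is `f 0` times the tail of g, plus `f ∘ suc ⊛ g`; linearity
    -- in the first factor then reduces the claim to `f ∘ suc`.
    ⊛-assoc : ∀ n f g h → ((f ⊛ g) ⊛ h) n ≡ (f ⊛ (g ⊛ h)) n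
    ⊛-assoc zero    f g h = ℤ.*-assoc (f 0) (g 0) (h 0)
    ⊛-assoc (suc n) f g h = begin
      f 0 * g 0 * h (suc n) + ((λ i → f 0 * g (suc i) + (f ∘ suc ⊛ g) i) ⊛ h) n
        ≡⟨ cong (f 0 * g 0 * h (suc n) +_) (trans (⊛-distribʳ n h _ _) (cong₂ _+_ (*-⊛ n (f 0) (g ∘ suc) h) (⊛-assoc n (f ∘ suc) g h))) ⟩
      f 0 * g 0 * h (suc n) + (f 0 * (g ∘ suc ⊛ h) n + (f ∘ suc ⊛ (g ⊛ h)) n)
        ≡⟨ factor (f 0) (g 0) (h (suc n)) _ _ ⟩
      f 0 * (g 0 * h (suc n) + (g ∘ suc ⊛ h) n) + (f ∘ suc ⊛ (g ⊛ h)) n ∎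
      where
      factor : ∀ a b c d e → a * b * c + (a * d + e) ≡ a * (b * c + d) + e
      factor = solve-∀

    -- The mirror image of the defining equation, splitting off the constant term of the second
    -- factor. Commutativity follows by playing the two against each other.
    ⊛-sucʳ : ∀ n f g → (f ⊛ g) (suc n) ≡ g 0 * f (suc n) + (f ⊛ g ∘ suc) n
    ⊛-sucʳ zero    f g = swap (f 0) (g 1) (f 1) (g 0)
      where
      swap : ∀ a b c d → a * b + c * d ≡ d * c + a * b
      swap = solve-∀
    ⊛-sucʳ (suc n) f g = trans (cong (f 0 * g (suc (suc n)) +_) (⊛-sucʳ n (f ∘ suc) g))
      (swap (f 0 * g (suc (suc n))) (g 0 * f (suc (suc n))) _)
      where
      swap : ∀ a b c → a + (b + c) ≡ b + (a + c)
      swap = solve-∀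

    ⊛-comm : ∀ n f g → (f ⊛ g) n ≡ (g ⊛ f) n
    ⊛-comm zero    f g = ℤ.*-comm (f 0) (g 0)
    ⊛-comm (suc n) f g = trans (⊛-sucʳ n f g) (cong (g 0 * f (suc n) +_) (⊛-comm n f (g ∘ suc)))

  -- ℤ[[x]] / x^{N+1}
  truncatedSeries : ℕ → CommutativeRing _ _
  truncatedSeries N = record
    { Carrier = Series
    ; _≈_ = λ f g → ∀ {i} → i ℕ.≤ N → f i ≡ g i
    ; _+_ = λ f g i → f i + g i
    ; _*_ = _⊛_
    ; -_ = λ f i → - f i
    ; 0# = 0ₛ
    ; 1# = 1ₛ
    ; isCommutativeRing = record
      { isRing = record
        { +-isAbelianGroup = record
          { isGroup = record
            { isMonoid = record
              { isSemigroup = record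
                { isMagma = record
                  { isEquivalence = record
                    { refl = λ _ → refl
                    ; sym = λ p i≤N → sym (p i≤N)
                    ; trans = λ p q i≤N → trans (p i≤N) (q i≤N)
                    }
                  ; ∙-cong = λ p q i≤N → cong₂ _+_ (p i≤N) (q i≤N)
                  }
                ; assoc = λ f g h {i} _ → ℤ.+-assoc (f i) (g i) (h i)
                }
              ; identity = (λ f {i} _ → ℤ.+-identityˡ (f i)) , (λ f {i} _ → ℤ.+-identityʳ (f i))
              }
            ; inverse = (λ f {i} _ → ℤ.+-inverseˡ (f i)) , (λ f {i} _ → ℤ.+-inverseʳ (f i))
            ; ⁻¹-cong = λ p i≤N → cong -_ (p i≤N)
            }
          ; comm = λ f g {i} _ → ℤ.+-comm (f i) (g i)
          }
        ; *-cong = λ p q {n} n≤N → ⊛-cong n (λ i≤n → p (ℕ.≤-trans i≤n n≤N)) (λ i≤n → q (ℕ.≤-trans i≤n n≤N))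
        ; *-assoc = λ f g h {n} _ → ⊛-assoc n f g h
        ; *-identity = (λ f {n} _ → ⊛-identityˡ n f) , (λ f {n} _ → trans (⊛-comm n f 1ₛ) (⊛-identityˡ n f))
        ; distrib = (λ f g h {n} _ → trans (⊛-comm n f _) (trans (⊛-distribʳ n f g h) (cong₂ _+_ (⊛-comm n g f) (⊛-comm n h f))))
                  , (λ f g h {n} _ → ⊛-distribʳ n f g h)
        }
      ; *-comm = λ f g {n} _ → ⊛-comm n f g
      }
    }

-- Counting the elements of each weight

module WeightedCounting where

  open TruncatedSeries
  open import Data.Empty using (⊥; ⊥-elim)
  open import Data.Fin as Fin using (Fin)
  import Data.Fin.Properties as Fin
  open import Data.Fin.Permutation using (↔⇒≡)
  import Data.Integer as ℤ
  open import Data.List using (List; length; lookup)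
  open import Data.List.Membership.Propositional using (_∈_)
  open import Data.List.Membership.Propositional.Properties using (∈-lookup)
  open import Data.List.Relation.Unary.Any.Properties using (lookup-index)
  import Data.List.Relation.Unary.All as All
  open import Data.List.Relation.Unary.Any using (index)
  open import Data.List.Relation.Unary.Unique.Propositional using (Unique; _∷_)
  open import Data.Nat as ℕ using (ℕ; zero; suc; z≤n; s≤s; _≤_; _<_; _+_; _*_)
  import Data.Nat.Properties as ℕ
  open import Data.Nat.Induction using (<-rec)
  open import Data.Product using (Σ; _×_; _,_; ∃; proj₁; proj₂)
  open import Data.Sum using (_⊎_; inj₁; inj₂; [_,_]′)
  open import Data.Sum.Function.Propositional using (_⊎-↔_)
  open import Data.Unit using (⊤; tt)
  open import Function using (_∘_; _↔_; mk↔ₛ′; Inverse)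
  open import Function.Construct.Composition using (_↔-∘_)
  open import Function.Construct.Symmetry using (↔-sym)
  open import Relation.Binary.PropositionalEquality
  open import Algebra.Bundles using (CommutativeRing)

  private variable
    A B : Set
    n : ℕ

  Fibre : (A → ℕ) → ℕ → Set
  Fibre w n = ∃ λ a → w a ≡ n

  fibre-≡ : ∀ {w : A → ℕ} {p q : Fibre w n} → proj₁ p ≡ proj₁ q → p ≡ q
  fibre-≡ {p = a , _} refl = cong (a ,_) (ℕ.≡-irrelevant _ _)

  Fibre-cong : ∀ {w : A → ℕ} {v : B → ℕ} (i : A ↔ B) → (∀ a → v (Inverse.to i a) ≡ w a) →
               ∀ n → Fibre w n ↔ Fibre v n
  Fibre-cong {v = v} i eq n = mk↔ₛ′
    (λ (a , p) → to a , trans (eq a) p)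
    (λ (b , q) → from b , trans (sym (eq (from b))) (trans (cong v (strictlyInverseˡ b)) q))
    (λ (b , _) → fibre-≡ (strictlyInverseˡ b))
    (λ (a , _) → fibre-≡ (strictlyInverseʳ a))
    where open Inverse i

  Fibre-⊎ : ∀ (w : A → ℕ) (v : B → ℕ) n → Fibre [ w , v ]′ n ↔ (Fibre w n ⊎ Fibre v n)
  Fibre-⊎ w v n = mk↔ₛ′
    (λ { (inj₁ a , p) → inj₁ (a , p) ; (inj₂ b , p) → inj₂ (b , p) })
    (λ { (inj₁ (a , p)) → inj₁ a , p ; (inj₂ (b , p)) → inj₂ b , p })
    (λ { (inj₁ _) → refl ; (inj₂ _) → refl })
    (λ { (inj₁ _ , _) → refl ; (inj₂ _ , _) → refl })

  Fibre-suc-zero : ∀ (w : A → ℕ) → Fibre (suc ∘ w) 0 ↔ ⊥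
  Fibre-suc-zero w = mk↔ₛ′ (λ ()) (λ ()) (λ ()) (λ ())

  Fibre-suc-suc : ∀ (w : A → ℕ) n → Fibre (suc ∘ w) (suc n) ↔ Fibre w n
  Fibre-suc-suc w n = mk↔ₛ′
    (λ (a , p) → a , ℕ.suc-injective p) (λ (a , p) → a , cong suc p)
    (λ _ → fibre-≡ refl) (λ _ → fibre-≡ refl)

  FiniteAt : (A → ℕ) → ℕ → Set
  FiniteAt w n = ∃ λ k → Fin k ↔ Fibre w n

  Finite : (A → ℕ) → Set
  Finite w = ∀ n → FiniteAt w n

  -- Bijective finite sets have equal size, so a coefficient does not depend on the enumeration that
  -- witnesses finiteness.
  card-unique : ∀ {w : A → ℕ} {v : B → ℕ} {m} (φ : FiniteAt w n) (ψ : FiniteAt v m) →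
                Fibre w n ↔ Fibre v m → proj₁ φ ≡ proj₁ ψ
  card-unique (_ , φ) (_ , ψ) i = ↔⇒≡ (↔-sym ψ ↔-∘ (i ↔-∘ φ))

  transport : ∀ {w : A → ℕ} {v : B → ℕ} {m} → Fibre w n ↔ Fibre v m → FiniteAt w n → FiniteAt v m
  transport i (k , φ) = k , i ↔-∘ φ

  -- Adjoining a part of size k with arbitrary multiplicity.
  repeat : ℕ → (A → ℕ) → (A × ℕ → ℕ)
  repeat k w (a , i) = i * k + w a

  -- Either the multiplicity is 0, or one copy of the part can be removed. On generating functions
  -- this reads R = W + x^k R.
  repeat-split : ∀ k (w : A → ℕ) n → Fibre (repeat k w) n ↔ Fibre [ w , (k +_) ∘ repeat k w ]′ n
  repeat-split k w = Fibre-cong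
    (mk↔ₛ′ (λ { (a , zero) → inj₁ a ; (a , suc i) → inj₂ (a , i) })
           (λ { (inj₁ a) → a , zero ; (inj₂ (a , i)) → a , suc i })
           (λ { (inj₁ _) → refl ; (inj₂ _) → refl })
           (λ { (_ , zero) → refl ; (_ , suc _) → refl }))
    (λ { (a , zero) → refl ; (a , suc i) → sym (ℕ.+-assoc k (i * k) (w a)) })

  finite-⊤ : Finite {⊤} (λ _ → 0)
  finite-⊤ zero    = 1 , mk↔ₛ′ (λ _ → tt , refl) (λ _ → Fin.zero) (λ _ → fibre-≡ refl) (λ { Fin.zero → refl ; (Fin.suc ()) })
  finite-⊤ (suc n) = 0 , mk↔ₛ′ (λ ()) (λ ()) (λ ()) (λ ())

  finite-⊎ : ∀ {w : A → ℕ} {v : B → ℕ} → FiniteAt w n → FiniteAt v n → FiniteAt [ w , v ]′ n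
  finite-⊎ (k , φ) (l , ψ) = k + l , ↔-sym (Fibre-⊎ _ _ _) ↔-∘ ((φ ⊎-↔ ψ) ↔-∘ Fin.+↔⊎)

  -- Finiteness is asked only at those m with `c + m ≡ n`, so that the recursion in `finite-repeat`
  -- can supply it at smaller weights.
  finite-+ : ∀ c {w : A → ℕ} n → (∀ m → c + m ≡ n → FiniteAt w m) → FiniteAt ((c +_) ∘ w) n
  finite-+ zero    n       φ = φ n refl
  finite-+ (suc c) zero    φ = 0 , ↔-sym (Fibre-suc-zero _) ↔-∘ Fin.0↔⊥
  finite-+ (suc c) (suc n) φ = transport (↔-sym (Fibre-suc-suc _ n)) (finite-+ c n (λ m eq → φ m (cong suc eq)))

  finite-shift : ∀ c {w : A → ℕ} → Finite w → Finite ((c +_) ∘ w)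
  finite-shift c φ n = finite-+ c n (λ m _ → φ m)

  -- Abstract, since unfolding the well-founded recursion makes conversion checking explode.
  abstract
    finite-repeat : ∀ k {w : A → ℕ} → Finite w → Finite (repeat (suc k) w)
    finite-repeat k {w} φ = <-rec _ λ n rec →
      transport (↔-sym (repeat-split (suc k) w n))
        (finite-⊎ (φ n) (finite-+ (suc k) n λ m eq → rec (subst (m <_) eq (s≤s (ℕ.m≤n+m m k)))))

  gf : {w : A → ℕ} → Finite w → Series
  gf φ n = ℤ.+ proj₁ (φ n)

  module _ (N : ℕ) where
    open CommutativeRing (truncatedSeries N) using (_≈_; semiring) renaming (_+_ to _⊕_)
    open import Algebra.Properties.Semiring.Exp semiring

    gf-⊤ : gf finite-⊤ ≈ 1ₛ
    gf-⊤ {zero}  _ = refl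
    gf-⊤ {suc _} _ = refl

    gf-+ : ∀ c {w : A → ℕ} (φ : Finite w) n → gf (finite-shift c φ) n ≡ (x ^ c ⊛ gf φ) n
    gf-+ zero    φ n       = sym (⊛-identityˡ n (gf φ))
    gf-+ (suc c) φ zero    = sym (⊛-assoc 0 x (x ^ c) (gf φ))
    gf-+ (suc c) φ (suc n) = trans (gf-+ c φ n)
      (trans (sym (x⊛-suc n (x ^ c ⊛ gf φ))) (sym (⊛-assoc (suc n) x (x ^ c) (gf φ))))

    -- The cardinality given by the abstract `finite-repeat` does not compute; `card-unique`
    -- compares it with that of the disjoint union in `repeat-split`.
    gf-repeat : ∀ k {w : A → ℕ} (φ : Finite w) →
                gf (finite-repeat k φ) ≈ gf φ ⊕ x ^ suc k ⊛ gf (finite-repeat k φ)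
    gf-repeat k {w} φ {n} _ = trans
      (cong ℤ.+_ (card-unique (finite-repeat k φ n) (finite-⊎ (φ n) (finite-shift (suc k) (finite-repeat k φ) n)) (repeat-split (suc k) w n)))
      (cong (λ z → gf φ n ℤ.+ z) (gf-+ (suc k) (finite-repeat k φ) n))

    x^-vanish : ∀ m {i} → i < m → (x ^ m) i ≡ ℤ.0ℤ
    x^-vanish (suc m) {zero}  _         = refl
    x^-vanish (suc m) {suc i} (s≤s i<m) = trans (x⊛-suc i (x ^ m)) (x^-vanish m i<m)

    x-nilpotent : x ^ suc N ≈ 0ₛ
    x-nilpotent i≤N = x^-vanish (suc N) (s≤s i≤N)

  module _ {V : ℕ → Set} (w : ∀ r → V r → ℕ) (φ : ∀ r → Finite (w r)) where

    total : Σ ℕ V → ℕ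
    total (r , a) = w r a

    ∑card : ℕ → ℕ → ℕ
    ∑card zero    n = proj₁ (φ 0 n)
    ∑card (suc R) n = ∑card R n + proj₁ (φ (suc R) n)

    -- Bounding the first component makes the fibre of `total` a finite disjoint union, built up one
    -- r at a time.
    Bounded : ℕ → ℕ → Set
    Bounded R n = ∃ λ (a : Σ ℕ V) → proj₁ a ≤ R × total a ≡ n

    bounded-≡ : ∀ {R} {p q : Bounded R n} → proj₁ p ≡ proj₁ q → p ≡ q
    bounded-≡ {p = a , _} refl = cong (a ,_) (cong₂ _,_ (ℕ.≤-irrelevant _ _) (ℕ.≡-irrelevant _ _))

    bounded-zero : ∀ n → Fibre (w 0) n ↔ Bounded 0 n
    bounded-zero n = mk↔ₛ′ (λ (a , p) → (0 , a) , z≤n , p) from (λ _ → bounded-≡ (eta _)) (λ _ → refl)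
      where
      from : Bounded 0 n → Fibre (w 0) n
      from ((0 , a) , z≤n , p) = a , p
      eta : (b : Bounded 0 n) → (0 , proj₁ (from b)) ≡ proj₁ b
      eta ((0 , a) , z≤n , p) = refl

    bounded-suc : ∀ R n → (Bounded R n ⊎ Fibre (w (suc R)) n) ↔ Bounded (suc R) n
    bounded-suc R n = mk↔ₛ′ to from to-from from-to
      where
      to : Bounded R n ⊎ Fibre (w (suc R)) n → Bounded (suc R) n
      to (inj₁ (a , r≤R , p)) = a , ℕ.m≤n⇒m≤1+n r≤R , p
      to (inj₂ (a , p))       = (suc R , a) , ℕ.≤-refl , p

      -- The comparison of r with `suc R` is a separate argument, so that the inverse laws can be
      -- proved by cases on an arbitrary comparison.
      from′ : ((a , _) : Bounded (suc R) n) → proj₁ a < suc R ⊎ proj₁ a ≡ suc R → Bounded R n ⊎ Fibre (w (suc R)) n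
      from′ (a , _ , p)       (inj₁ (s≤s r≤R)) = inj₁ (a , r≤R , p)
      from′ ((_ , a) , _ , p) (inj₂ refl)      = inj₂ (a , p)

      from : Bounded (suc R) n → Bounded R n ⊎ Fibre (w (suc R)) n
      from b@(_ , r≤ , _) = from′ b (ℕ.m≤n⇒m<n∨m≡n r≤)

      to-from′ : ∀ b d → to (from′ b d) ≡ b
      to-from′ b (inj₁ (s≤s _)) = bounded-≡ refl
      to-from′ b (inj₂ refl)    = bounded-≡ refl

      to-from : ∀ b → to (from b) ≡ b
      to-from b = to-from′ b _

      from-to′ : ∀ b d → from′ (to b) d ≡ b
      from-to′ (inj₁ _)             (inj₁ (s≤s _)) = cong inj₁ (bounded-≡ refl)
      from-to′ (inj₁ (_ , r≤R , _)) (inj₂ refl)    = ⊥-elim (ℕ.<-irrefl refl r≤R)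
      from-to′ (inj₂ _)             (inj₁ r<r)     = ⊥-elim (ℕ.<-irrefl refl r<r)
      from-to′ (inj₂ _)             (inj₂ refl)    = refl

      from-to : ∀ b → from (to b) ≡ b
      from-to b = from-to′ b _

    bounded-card : ∀ R n → Fin (∑card R n) ↔ Bounded R n
    bounded-card zero    n = bounded-zero n ↔-∘ proj₂ (φ 0 n)
    bounded-card (suc R) n = bounded-suc R n ↔-∘ ((bounded-card R n ⊎-↔ proj₂ (φ (suc R) n)) ↔-∘ Fin.+↔⊎)

    -- An element of weight n has r ≤ n ≤ N, so the bound N excludes nothing. One N for all n ≤ N
    -- lets the same finite sum of series serve every coefficient.
    total-card : (∀ r a → r ≤ w r a) → ∀ {N n} → n ≤ N → Fin (∑card N n) ↔ Fibre total n
    total-card r≤w {N} {n} n≤N = mk↔ₛ′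
      (λ (a , _ , p) → a , p)
      (λ ((r , a) , p) → (r , a) , ℕ.≤-trans (r≤w r a) (ℕ.≤-trans (ℕ.≤-reflexive p) n≤N) , p)
      (λ _ → refl) (λ _ → bounded-≡ refl) ↔-∘ bounded-card N n

  lookup-injective : ∀ {xs : List A} → Unique xs → ∀ {i j} → lookup xs i ≡ lookup xs j → i ≡ j
  lookup-injective (x∉ ∷ u) {Fin.zero}  {Fin.zero}  eq = refl
  lookup-injective (x∉ ∷ u) {Fin.zero}  {Fin.suc j} eq = ⊥-elim (All.lookup x∉ (∈-lookup j) eq)
  lookup-injective (x∉ ∷ u) {Fin.suc i} {Fin.zero}  eq = ⊥-elim (All.lookup x∉ (∈-lookup i) (sym eq))
  lookup-injective (x∉ ∷ u) {Fin.suc i} {Fin.suc j} eq = cong Fin.suc (lookup-injective u eq)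

  -- Positions in a duplicate-free list correspond to its members, and the injection `f` identifies
  -- these with the elements of B of weight n.
  length-unique : ∀ {v : B → ℕ} {xs : List A} (f : B → A) → Unique xs →
                  (∀ {b c} → f b ≡ f c → b ≡ c) →
                  (∀ b → v b ≡ n → f b ∈ xs) →
                  (∀ {a} → a ∈ xs → ∃ λ b → v b ≡ n × f b ≡ a) →
                  Fin (length xs) ↔ Fibre v n
  length-unique {v = v} {xs} f unique injective sound complete = mk↔ₛ′ to from
    (λ (b , p) → fibre-≡ (injective (trans (proj₂ (proj₂ (complete (∈-lookup (from (b , p)))))) (sym (lookup-index (sound b p))))))
    (λ k → lookup-injective unique (trans (sym (lookup-index (sound _ _))) (proj₂ (proj₂ (complete (∈-lookup k))))))
    where
    to : Fin (length xs) → Fibre v _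
    to k = let b , p , _ = complete (∈-lookup {xs = xs} k) in b , p
    from : Fibre v _ → Fin (length xs)
    from (b , p) = index (sound b p)

-- Generating functions of the families of pair lists

module GeneratingSeries where

  open RingIdentities
  open TruncatedSeries
  open WeightedCounting
  open import Algebra.Bundles using (CommutativeRing)
  import Data.Integer as ℤ
  import Data.Integer.Properties as ℤ
  import Data.Integer.Tactic.RingSolver as ℤ-Solver
  open import Data.Nat using (ℕ; zero; suc; _+_; _*_)
  import Data.Nat.Properties as ℕ
  open import Data.Product using (_×_; _,_)
  open import Data.Sum using (_⊎_; [_,_]′)
  open import Data.Unit using (⊤)
  open import Function using (_∘_)
  open import Relation.Binary.PropositionalEquality

  WithPair : Set → Set
  WithPair A = (A × ℕ) × ℕ

  -- A pair added to r others is the (r+1)-st from the outside, so a unit of either excess costs r +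
  -- 1. In `Ev` and `E` both the stored excesses and the weight are halved, so the cost is the same.
  block : {A : Set} → ℕ → (A → ℕ) → (WithPair A → ℕ)
  block r w = repeat (suc r) (repeat (suc r) w)

  finite-block : ∀ r {A} {w : A → ℕ} → Finite w → Finite (block r w)
  finite-block r φ = finite-repeat r (finite-repeat r φ)

  -- The pair lists of length r of general, self-conjugate and even-hook partitions (D, S, E); each
  -- suc adjoins the pair of a new innermost hook. Ev: lists in which every i + j is even. In Ev and E
  -- a pair is stored as (⌊ i /2⌋ , ⌊ j /2⌋), and the summand tells which of i and j are odd.
  D S Ev E : ℕ → Set
  D zero     = ⊤
  D (suc r)  = WithPair (D r)
  S zero     = ⊤
  S (suc r)  = S r × ℕ
  Ev zero    = ⊤
  Ev (suc r) = WithPair (Ev r) ⊎ WithPair (Ev r)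
  E zero     = ⊤
  E (suc r)  = WithPair (Ev r) ⊎ WithPair (Ev r)

  wD : ∀ r → D r → ℕ
  wD zero    _ = 0
  wD (suc r)   = (suc (r + r) +_) ∘ block r (wD r)

  -- Since i = j, a unit of the stored number costs r + 1 twice, once for the arm and once for the
  -- leg.
  wS : ∀ r → S r → ℕ
  wS zero    _ = 0
  wS (suc r)   = (suc (r + r) +_) ∘ repeat (suc r + suc r) (wS r)

  -- Half of (size + r), whereas wE is half of the size.
  wEv : ∀ r → Ev r → ℕ
  wEv zero    _ = 0
  wEv (suc r)   = [ (suc r +_) ∘ block r (wEv r) , (suc r +_) ∘ (suc r +_) ∘ block r (wEv r) ]′

  wE : ∀ r → E r → ℕ
  wE zero    _ = 0
  wE (suc r)   = [ (suc r +_) ∘ block r (wEv r) , (suc r +_) ∘ block r (wEv r) ]′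

  finite-D : ∀ r → Finite (wD r)
  finite-D zero    = finite-⊤
  finite-D (suc r) = finite-shift (suc (r + r)) (finite-block r (finite-D r))

  finite-S : ∀ r → Finite (wS r)
  finite-S zero    = finite-⊤
  -- `finite-repeat k` repeats a part of size `suc k`, and `suc (r + suc r)` is `suc r + suc r` by
  -- definition.
  finite-S (suc r) = finite-shift (suc (r + r)) (finite-repeat (r + suc r) (finite-S r))

  finite-Ev : ∀ r → Finite (wEv r)
  finite-Ev zero    = finite-⊤
  finite-Ev (suc r) n = finite-⊎ (finite-shift (suc r) (finite-block r (finite-Ev r)) n)
                                 (finite-shift (suc r) (finite-shift (suc r) (finite-block r (finite-Ev r))) n)

  finite-E : ∀ r → Finite (wE r)
  finite-E zero    = finite-⊤
  finite-E (suc r) n = finite-⊎ (finite-shift (suc r) (finite-block r (finite-Ev r)) n)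
                                (finite-shift (suc r) (finite-block r (finite-Ev r)) n)

  signed : Series → Series
  signed f i = ℤ.-1ℤ ℤ.^ i ℤ.* f i

  module GeneratingFunctions (N : ℕ) where

    open CommutativeRing (truncatedSeries N) using (_≈_; semiring; 1#; *-congˡ; *-congʳ; +-cong; +-congˡ; *-identityˡ; distribˡ; distribʳ)
      renaming (_+_ to _⊕_; _*_ to _⊗_; sym to ≈-sym; setoid to ≈-setoid; *-assoc to ⊗-assoc; *-comm to ⊗-comm)
    open import Algebra.Properties.Semiring.Exp semiring renaming (_^_ to _^ₛ_)
    open Nilpotent (truncatedSeries N) using (∑)
    open import Relation.Binary.Reasoning.Setoid ≈-setoid

    geo : ℕ → Series
    geo = Nilpotent.geometric (truncatedSeries N) x N (x-nilpotent N)

    gf-repeat-geo : ∀ k {A} {w : A → ℕ} (φ : Finite w) → gf (finite-repeat k φ) ≈ geo (suc k) ⊗ gf φ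
    gf-repeat-geo k φ = Nilpotent.geometric-unique (truncatedSeries N) x N (x-nilpotent N) k {gf φ} {gf (finite-repeat k φ)} (gf-repeat N k φ)

    gf-block : ∀ r {A} {w : A → ℕ} (φ : Finite w) → gf (finite-block r φ) ≈ geo (suc r) ⊗ (geo (suc r) ⊗ gf φ)
    gf-block r φ = begin
      gf (finite-block r φ)                       ≈⟨ gf-repeat-geo r (finite-repeat r φ) ⟩
      geo (suc r) ⊗ gf (finite-repeat r φ)        ≈⟨ *-congˡ {geo (suc r)} {gf (finite-repeat r φ)} (gf-repeat-geo r φ) ⟩
      geo (suc r) ⊗ (geo (suc r) ⊗ gf φ)          ∎

    gf-shift : ∀ c {A} {w : A → ℕ} (φ : Finite w) → gf (finite-shift c φ) ≈ x ^ₛ c ⊗ gf φ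
    gf-shift c φ {n} _ = gf-+ N c φ n

    gf-shift-block : ∀ c r {A} {w : A → ℕ} (φ : Finite w) →
                     gf (finite-shift c (finite-block r φ)) ≈ x ^ₛ c ⊗ (geo (suc r) ⊗ (geo (suc r) ⊗ gf φ))
    gf-shift-block c r φ = begin
      gf (finite-shift c (finite-block r φ))               ≈⟨ gf-shift c (finite-block r φ) ⟩
      x ^ₛ c ⊗ gf (finite-block r φ)                       ≈⟨ *-congˡ {x ^ₛ c} {gf (finite-block r φ)} (gf-block r φ) ⟩
      x ^ₛ c ⊗ (geo (suc r) ⊗ (geo (suc r) ⊗ gf φ))        ∎

    gf-E-suc : ∀ r → gf (finite-E (suc r)) ≈ (1# ⊕ 1#) ⊗ (x ^ₛ suc r ⊗ (geo (suc r) ⊗ (geo (suc r) ⊗ gf (finite-Ev r))))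
    gf-E-suc r = begin
      gf (finite-E (suc r))     ≈⟨ +-cong {f} {Y} {f} {Y} f≈Y f≈Y ⟩
      Y ⊕ Y
        ≈⟨ +-cong {Y} {1# ⊗ Y} {Y} {1# ⊗ Y} (≈-sym {1# ⊗ Y} {Y} (*-identityˡ Y)) (≈-sym {1# ⊗ Y} {Y} (*-identityˡ Y)) ⟩
      1# ⊗ Y ⊕ 1# ⊗ Y           ≈⟨ ≈-sym {(1# ⊕ 1#) ⊗ Y} (distribʳ Y 1# 1#) ⟩
      (1# ⊕ 1#) ⊗ Y             ∎
      where
      f = gf (finite-shift (suc r) (finite-block r (finite-Ev r)))
      Y = x ^ₛ suc r ⊗ (geo (suc r) ⊗ (geo (suc r) ⊗ gf (finite-Ev r)))
      f≈Y : f ≈ Y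
      f≈Y = gf-shift-block (suc r) r (finite-Ev r)

    gf-Ev-suc : ∀ r → gf (finite-Ev (suc r)) ≈ (1# ⊕ x ^ₛ suc r) ⊗ (x ^ₛ suc r ⊗ (geo (suc r) ⊗ (geo (suc r) ⊗ gf (finite-Ev r))))
    gf-Ev-suc r = begin
      gf (finite-Ev (suc r))          ≈⟨ +-cong {f} {Y} {gf (finite-shift (suc r) φ)} {x ^ₛ suc r ⊗ f} f≈Y (gf-shift (suc r) φ) ⟩
      Y ⊕ x ^ₛ suc r ⊗ f
        ≈⟨ +-cong {Y} {1# ⊗ Y} {x ^ₛ suc r ⊗ f} {x ^ₛ suc r ⊗ Y} (≈-sym {1# ⊗ Y} {Y} (*-identityˡ Y)) (*-congˡ {x ^ₛ suc r} {f} {Y} f≈Y) ⟩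
      1# ⊗ Y ⊕ x ^ₛ suc r ⊗ Y         ≈⟨ ≈-sym {(1# ⊕ x ^ₛ suc r) ⊗ Y} (distribʳ Y 1# (x ^ₛ suc r)) ⟩
      (1# ⊕ x ^ₛ suc r) ⊗ Y           ∎
      where
      φ = finite-shift (suc r) (finite-block r (finite-Ev r))
      f = gf φ
      Y = x ^ₛ suc r ⊗ (geo (suc r) ⊗ (geo (suc r) ⊗ gf (finite-Ev r)))
      f≈Y : f ≈ Y
      f≈Y = gf-shift-block (suc r) r (finite-Ev r)

    -- This is the equation of `gf-repeat` multiplied by the shift. It is kept as a recursion, the
    -- form to which `signed-S-suc` applies the sign.
    gf-S-suc : ∀ r → gf (finite-S (suc r)) ≈ x ^ₛ suc (r + r) ⊗ gf (finite-S r) ⊕ x ^ₛ (suc r + suc r) ⊗ gf (finite-S (suc r))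
    gf-S-suc r = begin
      f′                        ≈⟨ gf-shift c φ ⟩
      X ⊗ b                     ≈⟨ *-congˡ {X} {b} {f ⊕ Y ⊗ b} (gf-repeat N (r + suc r) (finite-S r)) ⟩
      X ⊗ (f ⊕ Y ⊗ b)           ≈⟨ distribˡ X f (Y ⊗ b) ⟩
      X ⊗ f ⊕ X ⊗ (Y ⊗ b)       ≈⟨ +-congˡ {X ⊗ f} {X ⊗ (Y ⊗ b)} {Y ⊗ f′} (begin
          X ⊗ (Y ⊗ b)   ≈⟨ ≈-sym {(X ⊗ Y) ⊗ b} (⊗-assoc X Y b) ⟩
          (X ⊗ Y) ⊗ b   ≈⟨ *-congʳ {b} {X ⊗ Y} (⊗-comm X Y) ⟩
          (Y ⊗ X) ⊗ b   ≈⟨ ⊗-assoc Y X b ⟩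
          Y ⊗ (X ⊗ b)   ≈⟨ *-congˡ {Y} {X ⊗ b} {f′} (≈-sym {f′} {X ⊗ b} (gf-shift c φ)) ⟩
          Y ⊗ f′        ∎) ⟩
      X ⊗ f ⊕ Y ⊗ f′            ∎
      where
      c = suc (r + r)
      φ = finite-repeat (r + suc r) (finite-S r)
      f′ = gf (finite-S (suc r))
      f = gf (finite-S r)
      b = gf φ
      X = x ^ₛ c
      Y = x ^ₛ (suc r + suc r)

    -- `signed` substitutes -x for x, which turns x^m into (-1)^m x^m.
    signed-shift : ∀ m f i → signed (x ^ₛ m ⊗ f) i ≡ ℤ.-1ℤ ℤ.^ m ℤ.* (x ^ₛ m ⊗ signed f) i
    signed-shift zero    f i       = trans (cong (ℤ.-1ℤ ℤ.^ i ℤ.*_) (⊛-identityˡ i f))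
      (sym (trans (ℤ.*-identityˡ _) (⊛-identityˡ i (signed f))))
    signed-shift (suc m) f zero    = trans (cong (ℤ.1ℤ ℤ.*_) (⊛-assoc 0 x (x ^ₛ m) f))
      (sym (trans (cong (ℤ.-1ℤ ℤ.^ suc m ℤ.*_) (⊛-assoc 0 x (x ^ₛ m) (signed f))) (ℤ.*-zeroʳ (ℤ.-1ℤ ℤ.^ suc m))))
    signed-shift (suc m) f (suc i) = ≡.begin
      ℤ.-1ℤ ℤ.* u ℤ.* (x ^ₛ suc m ⊗ f) (suc i)                   ≡.≡⟨ cong (ℤ.-1ℤ ℤ.* u ℤ.*_) (drop f) ⟩
      ℤ.-1ℤ ℤ.* u ℤ.* (x ^ₛ m ⊗ f) i                             ≡.≡⟨ ℤ.*-assoc ℤ.-1ℤ u _ ⟩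
      ℤ.-1ℤ ℤ.* (u ℤ.* (x ^ₛ m ⊗ f) i)                           ≡.≡⟨ cong (ℤ.-1ℤ ℤ.*_) (signed-shift m f i) ⟩
      ℤ.-1ℤ ℤ.* (ℤ.-1ℤ ℤ.^ m ℤ.* (x ^ₛ m ⊗ signed f) i)          ≡.≡⟨ sym (ℤ.*-assoc ℤ.-1ℤ (ℤ.-1ℤ ℤ.^ m) _) ⟩
      ℤ.-1ℤ ℤ.^ suc m ℤ.* (x ^ₛ m ⊗ signed f) i                  ≡.≡⟨ cong (ℤ.-1ℤ ℤ.^ suc m ℤ.*_) (sym (drop (signed f))) ⟩
      ℤ.-1ℤ ℤ.^ suc m ℤ.* (x ^ₛ suc m ⊗ signed f) (suc i)        ≡.∎
      where
      module ≡ = ≡-Reasoning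
      u = ℤ.-1ℤ ℤ.^ i
      drop : ∀ g → (x ^ₛ suc m ⊗ g) (suc i) ≡ (x ^ₛ m ⊗ g) i
      drop g = trans (⊛-assoc (suc i) x (x ^ₛ m) g) (x⊛-suc i (x ^ₛ m ⊗ g))

    -1^[r+r] : ∀ r → ℤ.-1ℤ ℤ.^ (r + r) ≡ ℤ.1ℤ
    -1^[r+r] zero    = refl
    -1^[r+r] (suc r) = trans (cong (λ n → ℤ.-1ℤ ℤ.* ℤ.-1ℤ ℤ.^ n) (ℕ.+-suc r r))
      (trans (cong (λ z → ℤ.-1ℤ ℤ.* (ℤ.-1ℤ ℤ.* z)) (-1^[r+r] r)) refl)

    signed-S : ℕ → Series
    signed-S r = signed (gf (finite-S r))

    -- Under x to -x the odd power x^(2r+1) in `gf-S-suc` changes sign and the even power x^(2r+2)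
    -- does not; the negative term is then moved to the left.
    signed-S-suc : ∀ r → signed-S (suc r) ⊕ x ^ₛ suc (r + r) ⊗ signed-S r ≈ x ^ₛ (suc r + suc r) ⊗ signed-S (suc r)
    signed-S-suc r {i} i≤N = ≡.begin
      u ℤ.* f′ i ℤ.+ a
        ≡.≡⟨ cong (λ z → u ℤ.* z ℤ.+ a) (gf-S-suc r i≤N) ⟩
      u ℤ.* ((x ^ₛ suc (r + r) ⊗ f) i ℤ.+ (x ^ₛ (suc r + suc r) ⊗ f′) i) ℤ.+ a
        ≡.≡⟨ cong (ℤ._+ a) (ℤ.*-distribˡ-+ u _ _) ⟩
      signed (x ^ₛ suc (r + r) ⊗ f) i ℤ.+ signed (x ^ₛ (suc r + suc r) ⊗ f′) i ℤ.+ a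
        ≡.≡⟨ cong₂ (λ y z → y ℤ.+ z ℤ.+ a)
               (trans (signed-shift (suc (r + r)) f i) (cong (λ z → ℤ.-1ℤ ℤ.* z ℤ.* a) (-1^[r+r] r)))
               (trans (signed-shift (suc r + suc r) f′ i) (cong (ℤ._* b) (-1^[r+r] (suc r)))) ⟩
      ℤ.-1ℤ ℤ.* ℤ.1ℤ ℤ.* a ℤ.+ ℤ.1ℤ ℤ.* b ℤ.+ a
        ≡.≡⟨ cancel a b ⟩
      b ≡.∎
      where
      module ≡ = ≡-Reasoning
      u = ℤ.-1ℤ ℤ.^ i
      f = gf (finite-S r)
      f′ = gf (finite-S (suc r))
      a = (x ^ₛ suc (r + r) ⊗ signed-S r) i
      b = (x ^ₛ (suc r + suc r) ⊗ signed-S (suc r)) i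
      cancel : ∀ a b → ℤ.-1ℤ ℤ.* ℤ.1ℤ ℤ.* a ℤ.+ ℤ.1ℤ ℤ.* b ℤ.+ a ≡ b
      cancel = ℤ-Solver.solve-∀

    signed-S-zero : signed-S 0 ≈ 1ₛ
    signed-S-zero {zero}  _ = refl
    signed-S-zero {suc i} _ = ℤ.*-zeroʳ (ℤ.-1ℤ ℤ.^ suc i)

    series-identity : ∑ N signed-S ⊗ ∑ N (gf ∘ finite-E) ≈ ∑ N (gf ∘ finite-D)
    series-identity = Nilpotent.product-identity (truncatedSeries N) x N (x-nilpotent N)
      {gf ∘ finite-D} {signed-S} {gf ∘ finite-Ev} {gf ∘ finite-E}
      (gf-⊤ N) signed-S-zero (gf-⊤ N) (gf-⊤ N)
      (λ r → gf-shift-block (suc (r + r)) r (finite-D r)) signed-S-suc gf-Ev-suc gf-E-suc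

    ∑-gf : ∀ {V : ℕ → Set} (w : ∀ r → V r → ℕ) (φ : ∀ r → Finite (w r)) R n → ∑ R (λ r → gf (φ r)) n ≡ ℤ.+ ∑card w φ R n
    ∑-gf w φ zero    n = refl
    ∑-gf w φ (suc R) n = cong (ℤ._+ gf (φ (suc R)) n) (∑-gf w φ R n)

    ∑-signed : ∀ (f : ℕ → Series) R n → ∑ R (λ r → signed (f r)) n ≡ signed (∑ R f) n
    ∑-signed f zero    n = refl
    ∑-signed f (suc R) n = trans (cong (ℤ._+ signed (f (suc R)) n) (∑-signed f R n)) (sym (ℤ.*-distribˡ-+ (ℤ.-1ℤ ℤ.^ n) _ _))

open import Defs

-- Partitions as nested diagonal hooks

module PairLists where

  open import Data.List using (List; []; _∷_; length; map; filter; applyUpTo; _ʳ++_)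
  open import Data.List.Properties using (map-applyUpTo; length-applyUpTo; filter-accept; filter-reject; filter-all; ∷-injective)
  open import Data.List.Relation.Unary.All as All using (All; []; _∷_)
  open import Data.List.Relation.Unary.Linked as Linked using (Linked; []; [-]; _∷_)
  open import Data.Nat
  open import Data.Nat.Divisibility using (_∣_; ∣m+n∣m⇒∣n; ∣m∣n⇒∣m+n; ∣-refl)
  open import Data.Nat.ListAction using (sum)
  open import Data.Nat.Properties
  open import Data.Nat.Tactic.RingSolver using (solve-∀)
  open import Data.Product using (_×_; _,_; ∃; proj₁; proj₂; swap)
  open import Function using (id)
  open import Relation.Binary.PropositionalEquality
  open import Relation.Nullary using (yes; no)

  -- grow n q: each of the at most n rows of q is lengthened by 1, missing rows counting as empty.
  grow : ℕ → List ℕ → List ℕ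
  grow zero    _        = []
  grow (suc n) []       = 1 ∷ grow n []
  grow (suc n) (q ∷ qs) = suc q ∷ grow n qs

  -- Removal of the first column. Stopping at the first row of length 1 is correct for partitions,
  -- as all later rows have length 1 too.
  shrink : List ℕ → List ℕ
  shrink (suc (suc q) ∷ qs) = suc q ∷ shrink qs
  shrink _                  = []

  -- Adds a diagonal hook around q, with arm row q 0 + i and leg length q + j.
  frame : ℕ → ℕ → List ℕ → List ℕ
  frame i j q = suc (row q 0 + i) ∷ grow (length q + j) q

  IsPartition : List ℕ → Set
  IsPartition q = Linked _≥_ q × All (0 <_) q

  length-grow : ∀ n q → length (grow n q) ≡ n
  length-grow zero    q        = refl
  length-grow (suc n) []       = cong suc (length-grow n [])
  length-grow (suc n) (_ ∷ qs) = cong suc (length-grow n qs)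

  sum-grow : ∀ n q → length q ≤ n → sum (grow n q) ≡ n + sum q
  sum-grow zero    []       _         = refl
  sum-grow (suc n) []       _         = cong suc (sum-grow n [] z≤n)
  sum-grow (suc n) (q ∷ qs) (s≤s len) = cong suc (trans (cong (q +_) (sum-grow n qs len)) (shuffle q n (sum qs)))
    where
    shuffle : ∀ a b c → a + (b + c) ≡ b + (a + c)
    shuffle = solve-∀

  grow-positive : ∀ n q → All (0 <_) (grow n q)
  grow-positive zero    q        = []
  grow-positive (suc n) []       = z<s ∷ grow-positive n []
  grow-positive (suc n) (_ ∷ qs) = z<s ∷ grow-positive n qs

  grow-decreasing : ∀ n {c q} → Linked _≥_ (c ∷ q) → Linked _≥_ (suc c ∷ grow n q)
  grow-decreasing zero    _                     = [-]
  grow-decreasing (suc n) {q = []}    _         = s≤s z≤n ∷ grow-decreasing n [-]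
  grow-decreasing (suc n) {q = _ ∷ _} (q≤c ∷ d) = s≤s q≤c ∷ grow-decreasing n d

  cons-decreasing : ∀ {c q} → row q 0 ≤ c → Linked _≥_ q → Linked _≥_ (c ∷ q)
  cons-decreasing {q = []}    _   _ = [-]
  cons-decreasing {q = _ ∷ _} q≤c d = q≤c ∷ d

  frame-isPartition : ∀ i j {q} → IsPartition q → IsPartition (frame i j q)
  frame-isPartition i j {q} (dec , _) =
    grow-decreasing (length q + j) (cons-decreasing (m≤m+n (row q 0) i) dec) , z<s ∷ grow-positive _ q

  shrink-grow : ∀ n {q} → All (0 <_) q → length q ≤ n → shrink (grow n q) ≡ q
  shrink-grow zero    []        _         = refl
  shrink-grow (suc n) []        _         = refl
  shrink-grow (suc n) (s≤s _ ∷ pos) (s≤s len) = cong (_ ∷_) (shrink-grow n pos len)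

  -- Parts bounded by 1 are all 1, which is what `grow` makes of missing rows. It covers the rows
  -- that `shrink` drops.
  grow-ones : ∀ {qs} → Linked _≥_ (1 ∷ qs) → All (0 <_) qs → grow (length qs) [] ≡ qs
  grow-ones {[]}              _               _         = refl
  grow-ones {suc zero ∷ _}    (_ ∷ dec)       (_ ∷ pos) = cong (1 ∷_) (grow-ones dec pos)
  grow-ones {suc (suc _) ∷ _} (s≤s () ∷ _)    _

  grow-shrink : ∀ {qs} → IsPartition qs → grow (length qs) (shrink qs) ≡ qs
  grow-shrink {[]}              _                 = refl
  grow-shrink {suc zero ∷ _}    (dec , _ ∷ pos)   = cong (1 ∷_) (grow-ones dec pos)
  grow-shrink {suc (suc _) ∷ _} (dec , _ ∷ pos)   = cong (_ ∷_) (grow-shrink (Linked.tail dec , pos))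

  shrink-isPartition : ∀ {qs} → IsPartition qs → IsPartition (shrink qs)
  shrink-isPartition {[]}              _               = [] , []
  shrink-isPartition {zero ∷ _}        _               = [] , []
  shrink-isPartition {suc zero ∷ _}    _               = [] , []
  shrink-isPartition {suc (suc _) ∷ _} (dec , _ ∷ pos) = shrink-decreasing dec pos , z<s ∷ proj₂ (shrink-isPartition (Linked.tail dec , pos))
    where
    shrink-decreasing : ∀ {q qs} → Linked _≥_ (suc (suc q) ∷ qs) → All (0 <_) qs → Linked _≥_ (suc q ∷ shrink qs)
    shrink-decreasing {qs = []}              _         _         = [-]
    shrink-decreasing {qs = zero ∷ _}        _         _         = [-]
    shrink-decreasing {qs = suc zero ∷ _}    _         _         = [-]
    shrink-decreasing {qs = suc (suc _) ∷ _} (s≤s q≤ ∷ d) (_ ∷ pos) = q≤ ∷ shrink-decreasing d pos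

  length-shrink : ∀ qs → length (shrink qs) ≤ length qs
  length-shrink []                  = z≤n
  length-shrink (zero ∷ _)          = z≤n
  length-shrink (suc zero ∷ _)      = z≤n
  length-shrink (suc (suc _) ∷ qs)  = s≤s (length-shrink qs)

  row-shrink : ∀ {p qs} → Linked _≥_ (suc p ∷ qs) → row (shrink qs) 0 ≤ p
  row-shrink {qs = []}              _           = z≤n
  row-shrink {qs = zero ∷ _}        _           = z≤n
  row-shrink {qs = suc zero ∷ _}    _           = z≤n
  row-shrink {qs = suc (suc _) ∷ _} (s≤s q≤ ∷ _) = q≤

  fromPairs : List (ℕ × ℕ) → List ℕ
  fromPairs []            = []
  fromPairs ((i , j) ∷ l) = frame i j (fromPairs l)

  fromPairs-isPartition : ∀ l → IsPartition (fromPairs l)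
  fromPairs-isPartition []            = [] , []
  fromPairs-isPartition ((i , j) ∷ l) = frame-isPartition i j (fromPairs-isPartition l)

  -- `shrink` recovers the inner partition from the rows below the first. Then the first row
  -- determines i and the number of rows determines j.
  fromPairs-injective : ∀ l m → fromPairs l ≡ fromPairs m → l ≡ m
  fromPairs-injective []            []              _  = refl
  fromPairs-injective ((i , j) ∷ l) ((i′ , j′) ∷ m) eq
    with heads , tails ← ∷-injective eq
    with refl ← fromPairs-injective l m (trans (sym (shrink-grow _ (proj₂ (fromPairs-isPartition l)) (m≤m+n _ j)))
                  (trans (cong shrink tails) (shrink-grow _ (proj₂ (fromPairs-isPartition m)) (m≤m+n _ j′))))
    with refl ← +-cancelˡ-≡ (row (fromPairs l) 0) i i′ (suc-injective heads)
    with refl ← +-cancelˡ-≡ (length (fromPairs l)) j j′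
                  (trans (sym (length-grow _ (fromPairs l))) (trans (cong length tails) (length-grow _ (fromPairs l))))
    = refl

  -- Peel off the outer hook and recurse on `shrink qs`. As this is no subterm of `qs`, the
  -- recursion runs on the bound n for the number of rows.
  fromPairs-surjective : ∀ n {ps} → length ps ≤ n → IsPartition ps → ∃ λ l → fromPairs l ≡ ps
  fromPairs-surjective n       {[]}         _         _             = [] , refl
  fromPairs-surjective (suc n) {suc p ∷ qs} (s≤s len) (dec , _ ∷ pos)
    with l , eq ← fromPairs-surjective n (≤-trans (length-shrink qs) len) (shrink-isPartition (Linked.tail dec , pos))
    = (p ∸ row (shrink qs) 0 , length qs ∸ length (shrink qs)) ∷ l ,
      trans (cong (frame _ _) eq)
        (cong₂ _∷_ (cong suc (m+[n∸m]≡n (row-shrink dec)))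
                   (trans (cong (λ n → grow n (shrink qs)) (m+[n∸m]≡n (length-shrink qs))) (grow-shrink (Linked.tail dec , pos))))

  -- Conjugation, hook lengths and size in terms of pairs

  column : List ℕ → ℕ → ℕ
  column ps c = length (filter (c <?_) ps)

  conjugate-applyUpTo : ∀ ps → conjugate ps ≡ applyUpTo (column ps) (row ps 0)
  conjugate-applyUpTo ps = map-applyUpTo id (column ps) (row ps 0)

  length-conjugate : ∀ ps → length (conjugate ps) ≡ row ps 0
  length-conjugate ps = trans (cong length (conjugate-applyUpTo ps)) (length-applyUpTo (column ps) (row ps 0))

  column-zero : ∀ {ps} → All (0 <_) ps → column ps 0 ≡ length ps
  column-zero pos = cong length (filter-all (0 <?_) pos)

  row-conjugate : ∀ {ps} → All (0 <_) ps → row (conjugate ps) 0 ≡ length ps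
  row-conjugate []                      = refl
  row-conjugate {suc p ∷ ps} pos@(_ ∷ _) = trans (cong (λ qs → row qs 0) (conjugate-applyUpTo (suc p ∷ ps))) (column-zero pos)

  column-accept : ∀ {p} ps {c} → c < p → column (p ∷ ps) c ≡ suc (column ps c)
  column-accept ps {c} c<p = cong length (filter-accept (c <?_) c<p)

  column-reject : ∀ {p} ps {c} → p ≤ c → column (p ∷ ps) c ≡ column ps c
  column-reject ps {c} p≤c = cong length (filter-reject (c <?_) (≤⇒≯ p≤c))

  -- Each old cell moves one column to the right, and the added rows of length 1 reach only column
  -- 0.
  column-grow : ∀ n q → length q ≤ n → ∀ c → column (grow n q) (suc c) ≡ column q c
  column-grow zero    []       _         c = refl
  column-grow (suc n) []       _         c = trans (column-reject (grow n []) (s≤s z≤n)) (column-grow n [] z≤n c)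
  column-grow (suc n) (q ∷ qs) (s≤s len) c with c <? q
  ... | yes c<q = trans (column-accept (grow n qs) (s≤s c<q)) (trans (cong suc (column-grow n qs len c)) (sym (column-accept qs c<q)))
  ... | no  c≮q = trans (column-reject (grow n qs) (s≤s (≮⇒≥ c≮q))) (trans (column-grow n qs len c) (sym (column-reject qs (≮⇒≥ c≮q))))

  column-vanish : ∀ {q} → Linked _≥_ q → ∀ {c} → row q 0 ≤ c → column q c ≡ 0
  column-vanish {[]}        _          _   = refl
  column-vanish {q ∷ []}    _          q≤c = column-reject [] q≤c
  column-vanish {q ∷ r ∷ s} (r≤q ∷ d)  q≤c = trans (column-reject (r ∷ s) q≤c) (column-vanish d (≤-trans r≤q q≤c))

  -- Meant for f the columns of q and g the columns of its frame after the first. From m to n the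
  -- columns of q are empty, and there `grow` supplies rows of length 1.
  grow-applyUpTo : ∀ n m {f g : ℕ → ℕ} → m ≤ n → (∀ {c} → m ≤ c → f c ≡ 0) → (∀ {c} → c < n → g c ≡ suc (f c)) →
                   grow n (applyUpTo f m) ≡ applyUpTo g n
  grow-applyUpTo zero    zero    _         f≡0 g≡ = refl
  grow-applyUpTo (suc n) zero    _         f≡0 g≡ = cong₂ _∷_ (sym (trans (g≡ z<s) (cong suc (f≡0 z≤n))))
    (grow-applyUpTo n zero z≤n (λ _ → f≡0 z≤n) (λ c<n → g≡ (s≤s c<n)))
  grow-applyUpTo (suc n) (suc m) (s≤s m≤n) f≡0 g≡ = cong₂ _∷_ (sym (g≡ z<s))
    (grow-applyUpTo n m m≤n (λ m≤c → f≡0 (s≤s m≤c)) (λ c<n → g≡ (s≤s c<n)))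

  -- Transposition exchanges the arm and leg of the new hook: column 0 of the frame is the corner
  -- with the leg, and column c + 1 is a cell of the arm on top of column c of q.
  conjugate-frame : ∀ i j {q} → IsPartition q → conjugate (frame i j q) ≡ frame j i (conjugate q)
  conjugate-frame i j {q} (dec , pos) = trans (conjugate-applyUpTo (frame i j q)) (cong₂ _∷_
    (trans (column-zero {frame i j q} (z<s ∷ grow-positive _ q))
      (cong suc (trans (length-grow _ q) (cong (_+ j) (sym (row-conjugate pos))))))
    (sym (trans (cong₂ grow (cong (_+ i) (length-conjugate q)) (conjugate-applyUpTo q))
      (grow-applyUpTo (row q 0 + i) (row q 0) (m≤m+n _ i) (column-vanish dec)
        (λ {c} c< → trans (column-accept (grow _ q) (s≤s c<)) (cong suc (column-grow _ q (m≤m+n _ j) c)))))))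

  conjugate-fromPairs : ∀ l → conjugate (fromPairs l) ≡ fromPairs (map swap l)
  conjugate-fromPairs []            = refl
  conjugate-fromPairs ((i , j) ∷ l) = trans (conjugate-frame i j (fromPairs-isPartition l)) (cong (frame j i) (conjugate-fromPairs l))

  -- Rows up to n get one cell longer, while later rows are empty before and after; truncated
  -- subtraction makes one equation cover both cases.
  row-grow : ∀ n q → length q ≤ n → ∀ k m → row (grow n q) k ∸ suc m ≡ row q k ∸ m
  row-grow zero    []       _         k       m = sym (0∸n≡0 m)
  row-grow (suc n) []       _         zero    m = refl
  row-grow (suc n) []       _         (suc k) m = row-grow n [] z≤n k m
  row-grow (suc n) (q ∷ qs) (s≤s len) zero    m = refl
  row-grow (suc n) (q ∷ qs) (s≤s len) (suc k) m = row-grow n qs len k m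

  -- m < n holds exactly when `n ∸ m` is nonzero. With `row-grow` this transfers the condition that
  -- a diagonal cell lies in the diagram.
  <-∸ : ∀ {m n o p} → n ∸ m ≡ p ∸ o → m < n → o < p
  <-∸ {m} {n} {o} {p} eq m<n = m∸n≢0⇒n<m λ p∸o≡0 → m>n⇒m∸n≢0 m<n (trans eq p∸o≡0)

  hookLength-frame-zero : ∀ i j {q} → IsPartition q → hookLength (frame i j q) 0 0 ≡ suc (row q 0 + length q + (i + j))
  hookLength-frame-zero i j {q} isP = begin
    row q 0 + i + (row (conjugate (frame i j q)) 0 ∸ 1) + 1   ≡⟨ cong (λ c → row q 0 + i + (c ∸ 1) + 1) (row-conjugate {frame i j q} (proj₂ (frame-isPartition i j isP))) ⟩
    row q 0 + i + length (grow (length q + j) q) + 1          ≡⟨ cong (λ c → row q 0 + i + c + 1) (length-grow _ q) ⟩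
    row q 0 + i + (length q + j) + 1                          ≡⟨ shuffle (row q 0) i (length q) j ⟩
    suc (row q 0 + length q + (i + j))                        ∎
    where
    open ≡-Reasoning
    shuffle : ∀ a i b j → a + i + (b + j) + 1 ≡ suc (a + b + (i + j))
    shuffle = solve-∀

  -- Framing moves q one step along the diagonal. Arms are handled by `row-grow`, legs by `row-grow`
  -- for the conjugate, which is again a frame.
  hookLength-frame-suc : ∀ i j {q} → IsPartition q → ∀ k → hookLength (frame i j q) (suc k) (suc k) ≡ hookLength q k k
  hookLength-frame-suc i j {q} isP k = cong (_+ 1) (cong₂ _+_
    (row-grow _ q (m≤m+n _ j) k (suc k))
    (trans (cong (λ qs → row qs (suc k) ∸ suc (suc k)) (conjugate-frame i j isP))
      (row-grow _ (conjugate q) (m≤m+n _ i) k (suc k))))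

  module _ (i j : ℕ) {q : List ℕ} (isP : IsPartition q) where

    evenHooks-frame⁺ : 2 ∣ suc (row q 0 + length q + (i + j)) → EvenDiagonalHooks q → EvenDiagonalHooks (frame i j q)
    evenHooks-frame⁺ e h zero    _  = subst (2 ∣_) (sym (hookLength-frame-zero i j isP)) e
    evenHooks-frame⁺ e h (suc k) k< = subst (2 ∣_) (sym (hookLength-frame-suc i j isP k))
      (h k (<-∸ (row-grow _ q (m≤m+n _ j) k k) k<))

    evenHooks-frame⁻ : EvenDiagonalHooks (frame i j q) → 2 ∣ suc (row q 0 + length q + (i + j)) × EvenDiagonalHooks q
    evenHooks-frame⁻ h = subst (2 ∣_) (hookLength-frame-zero i j isP) (h 0 z<s)
      , λ k k< → subst (2 ∣_) (hookLength-frame-suc i j isP k) (h (suc k) (<-∸ (sym (row-grow _ q (m≤m+n _ j) k k)) k<))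

  -- Half the perimeter of the bounding box; for nonempty `l`, one more than the outermost hook
  -- length. Together with i + j it determines the length of the next hook outside.
  height : List (ℕ × ℕ) → ℕ
  height l = row (fromPairs l) 0 + length (fromPairs l)

  height-∷ : ∀ i j l → height ((i , j) ∷ l) ≡ 2 + (height l + (i + j))
  height-∷ i j l = trans (cong (λ n → suc (row (fromPairs l) 0 + i) + suc n) (length-grow _ (fromPairs l)))
    (shuffle (row (fromPairs l) 0) i (length (fromPairs l)) j)
    where
    shuffle : ∀ a i b j → suc (a + i) + suc (b + j) ≡ 2 + (a + b + (i + j))
    shuffle = solve-∀

  -- The size of the partition when the first pair is the innermost one, whence the reversal in
  -- sum-reverse; fromPairs takes the outermost first.
  weight : List (ℕ × ℕ) → ℕ
  weight []            = 0
  weight ((i , j) ∷ l) = suc (length l + length l) + (j * suc (length l) + (i * suc (length l) + weight l))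

  -- The hooks of `l` lie around those of `m`. Each has its arm lengthened by the first row of the
  -- inner partition and its leg by its number of rows, so it gains `height m` cells.
  sum-ʳ++ : ∀ l m → sum (fromPairs (l ʳ++ m)) ≡ sum (fromPairs m) + length l * height m + weight l
  sum-ʳ++ []            m = sym (trans (+-identityʳ _) (+-identityʳ _))
  sum-ʳ++ ((i , j) ∷ l) m = begin
    sum (fromPairs (l ʳ++ ((i , j) ∷ m)))
      ≡⟨ sum-ʳ++ l ((i , j) ∷ m) ⟩
    suc (α + i) + sum (grow (β + j) q) + length l * height ((i , j) ∷ m) + weight l
      ≡⟨ cong₂ (λ s h → suc (α + i) + s + length l * h + weight l) (sum-grow _ q (m≤m+n β j)) (height-∷ i j m) ⟩
    suc (α + i) + (β + j + sum q) + length l * (2 + (α + β + (i + j))) + weight l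
      ≡⟨ shuffle α β i j (sum q) (length l) (weight l) ⟩
    sum q + suc (length l) * (α + β) + weight ((i , j) ∷ l) ∎
    where
    open ≡-Reasoning
    q = fromPairs m
    α = row q 0
    β = length q
    shuffle : ∀ α β i j s r w → suc (α + i) + (β + j + s) + r * (2 + (α + β + (i + j))) + w ≡
              s + suc r * (α + β) + (suc (r + r) + (j * suc r + (i * suc r + w)))
    shuffle = solve-∀

  odd-height : ∀ i j m → EvenDiagonalHooks (fromPairs ((i , j) ∷ m)) → 2 ∣ suc (height ((i , j) ∷ m))
  odd-height i j m h = subst (λ n → 2 ∣ suc n) (sym (height-∷ i j m))
    (∣m∣n⇒∣m+n ∣-refl (proj₁ (evenHooks-frame⁻ i j (fromPairs-isPartition m) h)))

  -- Around a nonempty partition with even hooks the height is odd, so a new hook of length height +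
  -- (a + b) + 1 is even iff a + b is. Hence the explicit pair (i , j) inside `l`.
  evenHooks-ʳ++⁺ : ∀ l i j m → All (λ (a , b) → 2 ∣ a + b) l → EvenDiagonalHooks (fromPairs ((i , j) ∷ m)) →
                   EvenDiagonalHooks (fromPairs (l ʳ++ ((i , j) ∷ m)))
  evenHooks-ʳ++⁺ []            i j m []       h = h
  evenHooks-ʳ++⁺ ((a , b) ∷ l) i j m (e ∷ es) h = evenHooks-ʳ++⁺ l a b ((i , j) ∷ m) es
    (evenHooks-frame⁺ a b (fromPairs-isPartition ((i , j) ∷ m)) (∣m∣n⇒∣m+n (odd-height i j m h) e) h)

  evenHooks-ʳ++⁻ : ∀ l m → EvenDiagonalHooks (fromPairs (l ʳ++ m)) → EvenDiagonalHooks (fromPairs m)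
  evenHooks-ʳ++⁻ []            m h = h
  evenHooks-ʳ++⁻ ((a , b) ∷ l) m h = proj₂ (evenHooks-frame⁻ a b (fromPairs-isPartition m) (evenHooks-ʳ++⁻ l ((a , b) ∷ m) h))

  evenHooks-ʳ++-even : ∀ l i j m → EvenDiagonalHooks (fromPairs (l ʳ++ ((i , j) ∷ m))) → All (λ (a , b) → 2 ∣ a + b) l
  evenHooks-ʳ++-even []            i j m h = []
  evenHooks-ʳ++-even ((a , b) ∷ l) i j m h
    with e , h′ ← evenHooks-frame⁻ a b (fromPairs-isPartition ((i , j) ∷ m)) (evenHooks-ʳ++⁻ l ((a , b) ∷ (i , j) ∷ m) h)
    = ∣m+n∣m⇒∣n e (odd-height i j m h′) ∷ evenHooks-ʳ++-even l a b ((i , j) ∷ m) h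

-- The three partition counts as coefficients of series

module PartitionCounts where

  open RingIdentities
  open TruncatedSeries
  open WeightedCounting
  open GeneratingSeries
  open PairLists
  open import Data.Empty using (⊥-elim)
  open import Data.Fin.Permutation using (↔⇒≡)
  import Data.Integer as ℤ
  import Data.Integer.Properties as ℤ
  open import Data.List using (List; []; _∷_; length; map; filter; reverse; _ʳ++_)
  open import Data.List.Membership.Propositional using (_∈_)
  open import Data.List.Membership.Propositional.Properties using (∈-filter⁺; ∈-filter⁻)
  open import Data.List.Properties using (∷-injective; filter-all; reverse-injective; reverse-involutive)
  open import Data.List.Relation.Unary.All as All using (All; []; _∷_)
  open import Data.List.Relation.Unary.Unique.Propositional.Properties using (filter⁺)
  open import Data.Nat
  open import Data.Nat.Divisibility using (_∣_; ∣m+n∣m⇒∣n; ∣m∣n⇒∣m+n; divides)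
  open import Data.Nat.Properties
  open import Data.Nat.ListAction using (sum)
  open import Data.Nat.Tactic.RingSolver using (solve-∀)
  open import Data.Product using (Σ; _×_; _,_; ∃; proj₁; swap)
  open import Data.Sum using (_⊎_; inj₁; inj₂)
  open import Data.Unit using (tt)
  open import Function using (_∘_; _⇔_; mk⇔; Equivalence)
  open import Function.Construct.Symmetry using (↔-sym)
  open import Function.Construct.Composition using (_↔-∘_)
  open import Relation.Binary.PropositionalEquality
  open import Relation.Nullary using (yes; ¬_)
  open import Relation.Unary using (Decidable)


  pairs-D : ∀ r → D r → List (ℕ × ℕ)
  pairs-D zero    _             = []
  pairs-D (suc r) ((a , i) , j) = (i , j) ∷ pairs-D r a

  pairs-S : ∀ r → S r → List (ℕ × ℕ)
  pairs-S zero    _       = []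
  pairs-S (suc r) (a , i) = (i , i) ∷ pairs-S r a

  pairs-Ev : ∀ r → Ev r → List (ℕ × ℕ)
  pairs-Ev zero    _                    = []
  pairs-Ev (suc r) (inj₁ ((a , i) , j)) = (i + i , j + j) ∷ pairs-Ev r a
  pairs-Ev (suc r) (inj₂ ((a , i) , j)) = (suc (i + i) , suc (j + j)) ∷ pairs-Ev r a

  pairs-E : ∀ r → E r → List (ℕ × ℕ)
  pairs-E zero    _                    = []
  pairs-E (suc r) (inj₁ ((a , i) , j)) = (suc (i + i) , j + j) ∷ pairs-Ev r a
  pairs-E (suc r) (inj₂ ((a , i) , j)) = (i + i , suc (j + j)) ∷ pairs-Ev r a

  length-D : ∀ r a → length (pairs-D r a) ≡ r
  length-D zero    _       = refl
  length-D (suc r) ((a , _) , _) = cong suc (length-D r a)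

  length-S : ∀ r a → length (pairs-S r a) ≡ r
  length-S zero    _       = refl
  length-S (suc r) (a , _) = cong suc (length-S r a)

  length-Ev : ∀ r a → length (pairs-Ev r a) ≡ r
  length-Ev zero    _                    = refl
  length-Ev (suc r) (inj₁ ((a , _) , _)) = cong suc (length-Ev r a)
  length-Ev (suc r) (inj₂ ((a , _) , _)) = cong suc (length-Ev r a)

  weight-D : ∀ r a → weight (pairs-D r a) ≡ wD r a
  weight-D zero    _             = refl
  weight-D (suc r) ((a , i) , j) = cong₂ (λ n w → suc (n + n) + (j * suc n + (i * suc n + w))) (length-D r a) (weight-D r a)

  weight-S : ∀ r a → weight (pairs-S r a) ≡ wS r a
  weight-S zero    _       = refl
  weight-S (suc r) (a , i) = trans
    (cong₂ (λ n w → suc (n + n) + (i * suc n + (i * suc n + w))) (length-S r a) (weight-S r a))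
    (rearrange r i (wS r a))
    where
    rearrange : ∀ r i w → suc (r + r) + (i * suc r + (i * suc r + w)) ≡ suc (r + r) + (i * (suc r + suc r) + w)
    rearrange = solve-∀

  -- For even i + j the k-th pair contributes the odd number 2k - 1 + k (i + j). Adding 1 for each
  -- of the r pairs makes everything divisible by 2; two odd entries cost a further 2k, the second
  -- shift in `wEv`.
  weight-Ev : ∀ r a → weight (pairs-Ev r a) + r ≡ 2 * wEv r a
  weight-Ev zero    _                    = refl
  weight-Ev (suc r) (inj₁ ((a , i) , j)) rewrite length-Ev r a = trans
    (gather r i j (weight (pairs-Ev r a)))
    (trans (cong (2 * (suc r + (j * suc r + i * suc r)) +_) (weight-Ev r a)) (spread r i j (wEv r a)))
    where
    gather : ∀ r i j w → suc (r + r) + ((j + j) * suc r + ((i + i) * suc r + w)) + suc r ≡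
             2 * (suc r + (j * suc r + i * suc r)) + (w + r)
    gather = solve-∀
    spread : ∀ r i j h → 2 * (suc r + (j * suc r + i * suc r)) + 2 * h ≡ 2 * (suc r + (j * suc r + (i * suc r + h)))
    spread = solve-∀
  weight-Ev (suc r) (inj₂ ((a , i) , j)) rewrite length-Ev r a = trans
    (gather r i j (weight (pairs-Ev r a)))
    (trans (cong (2 * (suc r + (suc r + (j * suc r + i * suc r))) +_) (weight-Ev r a)) (spread r i j (wEv r a)))
    where
    gather : ∀ r i j w → suc (r + r) + (suc (j + j) * suc r + (suc (i + i) * suc r + w)) + suc r ≡
             2 * (suc r + (suc r + (j * suc r + i * suc r))) + (w + r)
    gather = solve-∀
    spread : ∀ r i j h → 2 * (suc r + (suc r + (j * suc r + i * suc r))) + 2 * h ≡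
             2 * (suc r + (suc r + (j * suc r + (i * suc r + h))))
    spread = solve-∀

  -- With i + j = 2k + 1 the innermost pair contributes 2 (r + 1) + 2k (r + 1) + r, and this last r
  -- is the one that `weight-Ev` asks for.
  weight-odd-∷ : ∀ r i j k (a : Ev r) → i + j ≡ suc (k + k) →
                 weight ((i , j) ∷ pairs-Ev r a) ≡ 2 * (suc r + (k * suc r + wEv r a))
  weight-odd-∷ r i j k a eq rewrite length-Ev r a = begin
    suc (r + r) + (j * suc r + (i * suc r + w))          ≡⟨ gather r i j w ⟩
    suc (r + r) + (i + j) * suc r + w                    ≡⟨ cong (λ s → suc (r + r) + s * suc r + w) eq ⟩
    suc (r + r) + suc (k + k) * suc r + w                ≡⟨ regroup r k w ⟩
    2 * (suc r + k * suc r) + (w + r)                    ≡⟨ cong (2 * (suc r + k * suc r) +_) (weight-Ev r a) ⟩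
    2 * (suc r + k * suc r) + 2 * wEv r a                ≡⟨ spread r k (wEv r a) ⟩
    2 * (suc r + (k * suc r + wEv r a))                  ∎
    where
    open ≡-Reasoning
    w = weight (pairs-Ev r a)
    gather : ∀ r i j w → suc (r + r) + (j * suc r + (i * suc r + w)) ≡ suc (r + r) + (i + j) * suc r + w
    gather = solve-∀
    regroup : ∀ r k w → suc (r + r) + suc (k + k) * suc r + w ≡ 2 * (suc r + k * suc r) + (w + r)
    regroup = solve-∀
    spread : ∀ r k h → 2 * (suc r + k * suc r) + 2 * h ≡ 2 * (suc r + (k * suc r + h))
    spread = solve-∀

  weight-E : ∀ r a → weight (pairs-E r a) ≡ 2 * wE r a
  weight-E zero    _                    = refl
  weight-E (suc r) (inj₁ ((a , i) , j)) =
    trans (weight-odd-∷ r (suc (i + i)) (j + j) (j + i) a (odd-sum i j)) (split r i j (wEv r a))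
    where
    odd-sum : ∀ i j → suc (i + i) + (j + j) ≡ suc (j + i + (j + i))
    odd-sum = solve-∀
    split : ∀ r i j h → 2 * (suc r + ((j + i) * suc r + h)) ≡ 2 * (suc r + (j * suc r + (i * suc r + h)))
    split = solve-∀
  weight-E (suc r) (inj₂ ((a , i) , j)) =
    trans (weight-odd-∷ r (i + i) (suc (j + j)) (j + i) a (odd-sum i j)) (split r i j (wEv r a))
    where
    odd-sum : ∀ i j → i + i + suc (j + j) ≡ suc (j + i + (j + i))
    odd-sum = solve-∀
    split : ∀ r i j h → 2 * (suc r + ((j + i) * suc r + h)) ≡ 2 * (suc r + (j * suc r + (i * suc r + h)))
    split = solve-∀

  r≤wD : ∀ r a → r ≤ wD r a
  r≤wD zero    _ = z≤n
  r≤wD (suc r) _ = s≤s (≤-trans (m≤m+n r r) (m≤m+n (r + r) _))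

  r≤wS : ∀ r a → r ≤ wS r a
  r≤wS zero    _ = z≤n
  r≤wS (suc r) _ = s≤s (≤-trans (m≤m+n r r) (m≤m+n (r + r) _))

  r≤wE : ∀ r a → r ≤ wE r a
  r≤wE zero    _        = z≤n
  r≤wE (suc r) (inj₁ _) = m≤m+n (suc r) _
  r≤wE (suc r) (inj₂ _) = m≤m+n (suc r) _

  double-injective : ∀ {i j} → i + i ≡ j + j → i ≡ j
  double-injective {i} {j} eq = trans (n≡⌊n+n/2⌋ i) (trans (cong ⌊_/2⌋ eq) (sym (n≡⌊n+n/2⌋ j)))

  double≢suc-double : ∀ i j → i + i ≢ suc (j + j)
  -- `⌈ n /2⌉` unfolds to `⌊ suc n /2⌋`, so halving both sides gives i = j, and then a number would
  -- equal its successor.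
  double≢suc-double i j eq with refl ← trans (n≡⌊n+n/2⌋ i) (trans (cong ⌊_/2⌋ eq) (sym (n≡⌈n+n/2⌉ j))) = 1+n≢n (sym eq)

  halve : ∀ n → (∃ λ i → n ≡ i + i) ⊎ (∃ λ i → n ≡ suc (i + i))
  halve zero    = inj₁ (0 , refl)
  halve (suc n) with halve n
  ... | inj₁ (i , refl) = inj₂ (i , refl)
  ... | inj₂ (i , refl) = inj₁ (suc i , cong suc (sym (+-suc i i)))

  2∣double : ∀ n → 2 ∣ n + n
  2∣double n = divides n (trans (cong (n +_) (sym (+-identityʳ n))) (*-comm 2 n))

  2∤odd : ∀ n → ¬ 2 ∣ suc (n + n)
  2∤odd n (divides q eq) = double≢suc-double q n (sym (trans eq (trans (*-comm q 2) (cong (q +_) (+-identityʳ q)))))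

  injective-D : ∀ {r s} a b → pairs-D r a ≡ pairs-D s b → (r , a) ≡ (s , b)
  injective-D {zero}  {zero}  _             _              _  = refl
  injective-D {suc r} {suc s} ((a , i) , j) ((b , _) , _) eq
    with refl , eq′ ← ∷-injective eq with refl ← injective-D a b eq′ = refl

  injective-S : ∀ {r s} a b → pairs-S r a ≡ pairs-S s b → (r , a) ≡ (s , b)
  injective-S {zero}  {zero}  _       _       _  = refl
  injective-S {suc r} {suc s} (a , i) (b , _) eq
    with refl , eq′ ← ∷-injective eq with refl ← injective-S a b eq′ = refl

  ,-injective : {i j k l : ℕ} → (i , j) ≡ (k , l) → i ≡ k × j ≡ l
  ,-injective refl = refl , refl

  injective-Ev : ∀ {r s} a b → pairs-Ev r a ≡ pairs-Ev s b → (r , a) ≡ (s , b)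
  injective-Ev {zero}  {zero}  _ _ _ = refl
  injective-Ev {zero}  {suc s} _ (inj₁ _) ()
  injective-Ev {zero}  {suc s} _ (inj₂ _) ()
  injective-Ev {suc r} {zero}  (inj₁ _) _ ()
  injective-Ev {suc r} {zero}  (inj₂ _) _ ()
  injective-Ev {suc r} {suc s} (inj₁ ((a , i) , j)) (inj₁ ((b , k) , l)) eq
    with heads , tails ← ∷-injective eq
    with p , q ← ,-injective heads
    with refl ← double-injective {i} {k} p
    with refl ← double-injective {j} {l} q
    with refl ← injective-Ev a b tails = refl
  injective-Ev {suc r} {suc s} (inj₂ ((a , i) , j)) (inj₂ ((b , k) , l)) eq
    with heads , tails ← ∷-injective eq
    with p , q ← ,-injective heads
    with refl ← double-injective {i} {k} (suc-injective p)
    with refl ← double-injective {j} {l} (suc-injective q)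
    with refl ← injective-Ev a b tails = refl
  injective-Ev {suc r} {suc s} (inj₁ ((a , i) , j)) (inj₂ ((b , k) , l)) eq =
    ⊥-elim (double≢suc-double i k (proj₁ (,-injective (proj₁ (∷-injective eq)))))
  injective-Ev {suc r} {suc s} (inj₂ ((a , i) , j)) (inj₁ ((b , k) , l)) eq =
    ⊥-elim (double≢suc-double k i (sym (proj₁ (,-injective (proj₁ (∷-injective eq))))))

  injective-E : ∀ {r s} a b → pairs-E r a ≡ pairs-E s b → (r , a) ≡ (s , b)
  injective-E {zero}  {zero}  _ _ _ = refl
  injective-E {zero}  {suc s} _ (inj₁ _) ()
  injective-E {zero}  {suc s} _ (inj₂ _) ()
  injective-E {suc r} {zero}  (inj₁ _) _ ()
  injective-E {suc r} {zero}  (inj₂ _) _ ()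
  injective-E {suc r} {suc s} (inj₁ ((a , i) , j)) (inj₁ ((b , k) , l)) eq
    with heads , tails ← ∷-injective eq
    with p , q ← ,-injective heads
    with refl ← double-injective {i} {k} (suc-injective p)
    with refl ← double-injective {j} {l} q
    with refl ← injective-Ev a b tails = refl
  injective-E {suc r} {suc s} (inj₂ ((a , i) , j)) (inj₂ ((b , k) , l)) eq
    with heads , tails ← ∷-injective eq
    with p , q ← ,-injective heads
    with refl ← double-injective {i} {k} p
    with refl ← double-injective {j} {l} (suc-injective q)
    with refl ← injective-Ev a b tails = refl
  injective-E {suc r} {suc s} (inj₁ ((a , i) , j)) (inj₂ ((b , k) , l)) eq =
    ⊥-elim (double≢suc-double k i (sym (proj₁ (,-injective (proj₁ (∷-injective eq))))))
  injective-E {suc r} {suc s} (inj₂ ((a , i) , j)) (inj₁ ((b , k) , l)) eq =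
    ⊥-elim (double≢suc-double i k (proj₁ (,-injective (proj₁ (∷-injective eq)))))

  image-D : ∀ l → ∃ λ ((r , a) : Σ ℕ D) → pairs-D r a ≡ l
  image-D []            = (0 , tt) , refl
  image-D ((i , j) ∷ l) with (r , a) , refl ← image-D l = (suc r , ((a , i) , j)) , refl

  image-S : ∀ l → map swap l ≡ l → ∃ λ ((r , a) : Σ ℕ S) → pairs-S r a ≡ l
  image-S []            _  = (0 , tt) , refl
  image-S ((i , j) ∷ l) eq
    with refl , eq′ ← ∷-injective eq with (r , a) , refl ← image-S l eq′ = (suc r , (a , i)) , refl

  image-Ev : ∀ l → All (λ (i , j) → 2 ∣ i + j) l → ∃ λ ((r , a) : Σ ℕ Ev) → pairs-Ev r a ≡ l
  image-Ev []            _        = (0 , tt) , refl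
  image-Ev ((i , j) ∷ l) (e ∷ es) with image-Ev l es | halve i | halve j
  ... | (r , a) , refl | inj₁ (i , refl) | inj₁ (j , refl) = (suc r , inj₁ ((a , i) , j)) , refl
  ... | (r , a) , refl | inj₂ (i , refl) | inj₂ (j , refl) = (suc r , inj₂ ((a , i) , j)) , refl
  ... | (r , a) , refl | inj₁ (i , refl) | inj₂ (j , refl) = ⊥-elim (2∤odd j (∣m+n∣m⇒∣n e (2∣double i)))
  ... | (r , a) , refl | inj₂ (i , refl) | inj₁ (j , refl) =
    ⊥-elim (2∤odd i (∣m+n∣m⇒∣n (subst (2 ∣_) (+-comm (suc (i + i)) (j + j)) e) (2∣double j)))

  symmetric-S : ∀ r a → map swap (pairs-S r a) ≡ pairs-S r a
  symmetric-S zero    _       = refl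
  symmetric-S (suc r) (a , i) = cong ((i , i) ∷_) (symmetric-S r a)

  even-Ev : ∀ r a → All (λ (i , j) → 2 ∣ i + j) (pairs-Ev r a)
  even-Ev zero    _                    = []
  even-Ev (suc r) (inj₁ ((a , i) , j)) = ∣m∣n⇒∣m+n (2∣double i) (2∣double j) ∷ even-Ev r a
  even-Ev (suc r) (inj₂ ((a , i) , j)) = subst (2 ∣_) (rearrange i j) (∣m∣n⇒∣m+n (2∣double (suc i)) (2∣double j)) ∷ even-Ev r a
    where
    rearrange : ∀ i j → suc i + suc i + (j + j) ≡ suc (i + i) + suc (j + j)
    rearrange = solve-∀

  -- The innermost hook surrounds the empty partition and has length i + j + 1, even because exactly
  -- one of i and j is odd. The hooks around it are covered by `evenHooks-ʳ++⁺`.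
  evenHooks-E : ∀ r a → EvenDiagonalHooks (fromPairs (reverse (pairs-E r a)))
  evenHooks-E zero    _                    = λ _ ()
  evenHooks-E (suc r) (inj₁ ((a , i) , j)) = evenHooks-ʳ++⁺ (pairs-Ev r a) _ _ [] (even-Ev r a)
    (evenHooks-frame⁺ _ _ (fromPairs-isPartition [])
      (subst (2 ∣_) (rearrange i j) (∣m∣n⇒∣m+n (2∣double (suc i)) (2∣double j))) (λ _ ()))
    where
    rearrange : ∀ i j → suc i + suc i + (j + j) ≡ suc (suc (i + i) + (j + j))
    rearrange = solve-∀
  evenHooks-E (suc r) (inj₂ ((a , i) , j)) = evenHooks-ʳ++⁺ (pairs-Ev r a) _ _ [] (even-Ev r a)
    (evenHooks-frame⁺ _ _ (fromPairs-isPartition [])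
      (subst (2 ∣_) (rearrange i j) (∣m∣n⇒∣m+n (2∣double (suc i)) (2∣double j))) (λ _ ()))
    where
    rearrange : ∀ i j → suc i + suc i + (j + j) ≡ suc ((i + i) + suc (j + j))
    rearrange = solve-∀

  image-E : ∀ l → EvenDiagonalHooks (fromPairs (reverse l)) → ∃ λ ((r , a) : Σ ℕ E) → pairs-E r a ≡ l
  image-E []            _ = (0 , tt) , refl
  image-E ((i , j) ∷ l) h
    with image-Ev l (evenHooks-ʳ++-even l i j [] h)
       | proj₁ (evenHooks-frame⁻ i j (fromPairs-isPartition []) (evenHooks-ʳ++⁻ l ((i , j) ∷ []) h))
       | halve i | halve j
  ... | (r , a) , refl | e | inj₂ (i , refl) | inj₁ (j , refl) = (suc r , inj₁ ((a , i) , j)) , refl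
  ... | (r , a) , refl | e | inj₁ (i , refl) | inj₂ (j , refl) = (suc r , inj₂ ((a , i) , j)) , refl
  ... | (r , a) , refl | e | inj₁ (i , refl) | inj₁ (j , refl) =
    ⊥-elim (2∤odd j (∣m+n∣m⇒∣n (subst (2 ∣_) (sym (+-suc (i + i) (j + j))) e) (2∣double i)))
  ... | (r , a) , refl | e | inj₂ (i , refl) | inj₂ (j , refl) =
    ⊥-elim (2∤odd j (∣m+n∣m⇒∣n (subst (2 ∣_) (rearrange i j) e) (2∣double (suc i))))
    where
    rearrange : ∀ i j → suc (suc (i + i) + suc (j + j)) ≡ suc i + suc i + suc (j + j)
    rearrange = solve-∀

  sum-reverse : ∀ l → sum (fromPairs (reverse l)) ≡ weight l
  sum-reverse l = trans (sum-ʳ++ l []) (cong (_+ weight l) (*-zeroʳ (length l)))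

  module _ {V : ℕ → Set} {w : ∀ r → V r → ℕ} (φ : ∀ r → Finite (w r)) (r≤w : ∀ r a → r ≤ w r a)
           (pairs : ∀ r → V r → List (ℕ × ℕ)) (injective : ∀ {r s} a b → pairs r a ≡ pairs s b → (r , a) ≡ (s , b))
           {P : List ℕ → Set} (P? : Decidable P)
           (sound : ∀ r a → P (fromPairs (reverse (pairs r a))))
           (image : ∀ l → P (fromPairs (reverse l)) → ∃ λ ((r , a) : Σ ℕ V) → pairs r a ≡ l)
           where

    partition : Σ ℕ V → List ℕ
    partition (r , a) = fromPairs (reverse (pairs r a))

    partition-injective : ∀ {b c} → partition b ≡ partition c → b ≡ c
    partition-injective {r , a} {s , b} eq = injective a b (reverse-injective (fromPairs-injective _ _ eq))

    -- The scheme behind all three counts: `partition` matches the weighted family with the filtered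
    -- list. Size m and weight n are kept apart because for even hooks the weight is half of the
    -- size.
    length-filter-partitions : ∀ {m n N} → n ≤ N → (∀ r a → weight (pairs r a) ≡ m ⇔ w r a ≡ n) →
                               length (filter P? (partitions m)) ≡ ∑card w φ N n
    length-filter-partitions {m} {n} {N} n≤N weights = sym (↔⇒≡ (↔-sym (length-unique partition
        (filter⁺ P? (partitions-unique m)) partition-injective member preimage) ↔-∘ total-card w φ r≤w n≤N))
      where
      member : ∀ b → total w φ b ≡ n → partition b ∈ filter P? (partitions m)
      member (r , a) w≡n = ∈-filter⁺ P? (Equivalence.from ∈-partitions
        (let dec , pos = fromPairs-isPartition (reverse (pairs r a)) in
         mk⊢ dec pos (trans (sum-reverse (pairs r a)) (Equivalence.from (weights r a) w≡n)))) (sound r a)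
      preimage : ∀ {ps} → ps ∈ filter P? (partitions m) → ∃ λ b → total w φ b ≡ n × partition b ≡ ps
      preimage {ps} ps∈
        with ps∈p , Pps ← ∈-filter⁻ P? {xs = partitions m} ps∈
        with mk⊢ dec pos sum≡ ← Equivalence.to ∈-partitions ps∈p
        with l , refl ← fromPairs-surjective (length ps) ≤-refl (dec , pos)
        with (r , a) , eq ← image (reverse l) (subst (P ∘ fromPairs) (sym (reverse-involutive l)) Pps)
        = (r , a) , Equivalence.to (weights r a) (trans (sym (sum-reverse (pairs r a))) (trans (cong sum same) sum≡)) , same
        where
        same : partition (r , a) ≡ fromPairs l
        same = cong fromPairs (trans (cong reverse eq) (reverse-involutive l))

  map-swap-ʳ++ : ∀ (l m : List (ℕ × ℕ)) → map swap (l ʳ++ m) ≡ map swap l ʳ++ map swap m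
  map-swap-ʳ++ []      m = refl
  map-swap-ʳ++ (x ∷ l) m = map-swap-ʳ++ l (x ∷ m)

  conjugate-reverse : ∀ l → conjugate (fromPairs (reverse l)) ≡ fromPairs (reverse (map swap l))
  conjugate-reverse l = trans (conjugate-fromPairs (reverse l)) (cong fromPairs (map-swap-ʳ++ l []))

  p-card : ∀ {n N} → n ≤ N → p n ≡ ∑card wD finite-D N n
  p-card {n} n≤N = trans
    -- A filter that accepts everything brings `p` into the common form.
    (cong length (sym (filter-all (λ _ → yes tt) (All.universal (λ _ → tt) (partitions n)))))
    (length-filter-partitions finite-D r≤wD pairs-D injective-D (λ _ → yes tt) (λ _ _ → tt) (λ l _ → image-D l) n≤N
      (λ r a → mk⇔ (trans (sym (weight-D r a))) (trans (weight-D r a))))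

  -- Conjugation swaps the entries of every pair and `fromPairs` is injective, so self-conjugacy
  -- means i = j throughout.
  sc-card : ∀ {n N} → n ≤ N → sc n ≡ ∑card wS finite-S N n
  sc-card n≤N = length-filter-partitions finite-S r≤wS pairs-S injective-S selfConjugate?
    (λ r a → trans (conjugate-reverse (pairs-S r a)) (cong (fromPairs ∘ reverse) (symmetric-S r a)))
    (λ l sc → image-S l (reverse-injective (fromPairs-injective _ _ (trans (sym (conjugate-reverse l)) sc))))
    n≤N (λ r a → mk⇔ (trans (sym (weight-S r a))) (trans (weight-S r a)))

  Hₑᵥₑₙ-card : ∀ {n N} → n ≤ N → #Hₑᵥₑₙ (2 * n) ≡ ∑card wE finite-E N n
  Hₑᵥₑₙ-card {n} n≤N = length-filter-partitions finite-E r≤wE pairs-E injective-E evenDiagonalHooks? evenHooks-E image-E n≤N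
    (λ r a → mk⇔ (λ eq → *-cancelˡ-≡ (wE r a) n 2 (trans (sym (weight-E r a)) eq))
                 (λ eq → trans (weight-E r a) (cong (2 *_) eq)))

  ∑≤-cong : ∀ n {f g} → (∀ {j} → j ≤ n → f j ≡ g j) → ∑≤ n f ≡ ∑≤ n g
  ∑≤-cong zero    eq = eq z≤n
  ∑≤-cong (suc n) eq = cong₂ ℤ._+_ (∑≤-cong n (λ j≤n → eq (m≤n⇒m≤1+n j≤n))) (eq ≤-refl)

  -- `∑≤` recurses at its upper end and `_⊛_` at its lower end; this reconciles them in `⊛-∑≤`.
  ∑≤-suc : ∀ n f → ∑≤ (suc n) f ≡ f 0 ℤ.+ ∑≤ n (f ∘ suc)
  ∑≤-suc zero    f = refl
  ∑≤-suc (suc n) f = trans (cong (ℤ._+ f (suc (suc n))) (∑≤-suc n f)) (ℤ.+-assoc (f 0) _ _)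

  ⊛-∑≤ : ∀ n f g → (f ⊛ g) n ≡ ∑≤ n (λ j → f j ℤ.* g (n ∸ j))
  ⊛-∑≤ zero    f g = refl
  ⊛-∑≤ (suc n) f g = trans (cong (λ z → f 0 ℤ.* g (suc n) ℤ.+ z) (⊛-∑≤ n (f ∘ suc) g)) (sym (∑≤-suc n _))

-- The convolution formula

open import Data.Nat as ℕ using (ℕ; _∸_)
open import Data.Integer using (+_; -1ℤ; _*_; _^_)
open import Relation.Binary.PropositionalEquality using (_≡_)

corollary5p5 : ∀ (n : ℕ) →
    + p n ≡ ∑≤ n (λ j → -1ℤ ^ j * + sc j * + #Hₑᵥₑₙ (2 ℕ.* (n ∸ j)))
corollary5p5 n = begin
  + p n                                                   ≡⟨ cong +_ (p-card {n} {n} ≤-refl) ⟩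
  + ∑card wD finite-D n n                                 ≡⟨ sym (∑-gf wD finite-D n n) ⟩
  -- Truncation at degree n still retains the coefficient of x^n. The same n bounds the number of
  -- hooks in each sum, as a list of r pairs has weight at least r.
  ∑ n (gf ∘ finite-D) n                                   ≡⟨ sym (series-identity ≤-refl) ⟩
  (∑ n signed-S ⊛ ∑ n (gf ∘ finite-E)) n                  ≡⟨ ⊛-∑≤ n _ _ ⟩
  ∑≤ n (λ j → ∑ n signed-S j * ∑ n (gf ∘ finite-E) (n ∸ j))
    ≡⟨ ∑≤-cong n (λ {j} j≤n → cong₂ _*_
         (trans (∑-signed (gf ∘ finite-S) n j)
           (cong (-1ℤ ^ j *_) (trans (∑-gf wS finite-S n j) (cong +_ (sym (sc-card j≤n))))))
         (trans (∑-gf wE finite-E n (n ∸ j)) (cong +_ (sym (Hₑᵥₑₙ-card (m∸n≤m n j)))))) ⟩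
  ∑≤ n (λ j → -1ℤ ^ j * + sc j * + #Hₑᵥₑₙ (2 ℕ.* (n ∸ j))) ∎
  where
  open import Data.Nat.Properties using (≤-refl; m∸n≤m)
  open import Function using (_∘_)
  open import Relation.Binary.PropositionalEquality using (sym; trans; cong; cong₂; module ≡-Reasoning)
  open ≡-Reasoning
  open TruncatedSeries using (_⊛_; truncatedSeries)
  open RingIdentities.Nilpotent (truncatedSeries n) using (∑)
  open WeightedCounting using (gf; ∑card)
  open GeneratingSeries
  open GeneratingFunctions n
  open PartitionCounts
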